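{- Let $q,\alpha_1,\alpha_2,\alpha_3\in\mathbb{Q}$ with $q>5$, $\alpha_1\notin[-2,0]$, $\alpha_2\in(-2,0)$ and $\alpha_3<-1$. Suppose that $T^-$ and $T^+$ satisfy $0<T^-\le T^+$. Given a target edge-weight $T^*\in[T^-,T^+]$ and a positive value $\pi$ which is sufficiently small with respect to $q,\alpha_1,\alpha_2,\alpha_3,T^-,T^+$, there is a planar graph $\Upsilon$ (depending on $T^*$ and $\pi$) and a weight function $\widehat w:E(\Upsilon)\to\{\alpha_1,\alpha_2,\alpha_3\}$ that implements a weight $w^*$ with $T^*-\pi\le w^*\le T^*$. The size of $\Upsilon$ is at most a polynomial in $\log(\pi^{ -1})$. (This upper bound on the size of $\Upsilon$ does not depend on $T^*$, though it does depend on the fixed bounds $T^-$ and $T^+$.)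
   Context: Graphs are finite and may have loops and multiple edges. The number $q$ is fixed. A planar graph $\Upsilon$ with distinct distinguished vertices $s,t$ on the outer face and weights $\widehat w:E(\Upsilon)\to\mathbb{Q}$ implements the weight $w^*$ if $Z_{s|t}(\Upsilon)\ne0$ and $w^*=qZ_{st}(\Upsilon)/Z_{s|t}(\Upsilon)$. Here $Z_{st}(\Upsilon)$ (resp. $Z_{s|t}(\Upsilon)$) is the sum of $\big(\prod_{e\in A}\widehat w(e)\big)q^{\kappa(V(\Upsilon),A)}$ over all $A\subseteq E(\Upsilon)$ such that $s,t$ are in the same component (resp. different components) of $(V(\Upsilon),A)$, and $\kappa(V(\Upsilon),A)$ is the number of connected components of $(V(\Upsilon),A)$. The polynomial in the size bound may depend on $q,\alpha_1,\alpha_2,\alpha_3,T^-,T^+$ but not on $\pi$ or $T^*$. -}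

module Defs where

import Algebra.Definitions.RawSemiring as RawSemiringDefs
open import Data.Bool.Base using (Bool; true; false; not)
open import Data.Fin.Base as Fin using (Fin)
import Data.Fin.Properties as Fin
open import Data.Fin.Subset using (Subset; inside; outside; ⊤; _∈_)
open import Data.Fin.Subset.Properties using (_∈?_)
open import Data.List.Base using (List; []; _∷_; [_]; _++_; map; filter; foldr; length; allFin)
open import Data.List.Membership.Propositional using () renaming (_∈_ to _∈ˡ_)
open import Data.List.Membership.Propositional.Properties using (∈-map⁺; ∈-map⁻; ∈-filter⁺; ∈-filter⁻; ∈-allFin)
open import Data.List.Relation.Unary.Any using (here; there)
open import Data.Nat.Base as ℕ using (ℕ; zero; suc)
open import Data.Product.Base using (Σ; ∃; _×_; _,_; proj₁; proj₂)
open import Data.Rational.Base as ℚ using (ℚ; 0ℚ; 1ℚ; _+_; _*_; _-_; -_; _÷_; _<_; ≢-nonZero; +-*-rawSemiring)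
import Data.Rational.Properties as ℚ
open import Data.Sum.Base using (_⊎_; inj₁; inj₂)
open import Data.Vec.Base using ([]; _∷_)
open import Function.Base using (_∘_)
open import Function.Bundles using (_⇔_; mk⇔; _↔_; Inverse; Equivalence)
open import Function.Definitions using (Surjective)
open import Level using (0ℓ)
open import Relation.Binary.Core using (Rel)
open import Relation.Binary.Definitions using (Decidable)
open import Relation.Binary.Construct.Closure.Equivalence as EqC using (EqClosure)
open import Relation.Binary.Construct.Closure.ReflexiveTransitive using (ε; _◅_; _◅◅_)
open import Relation.Binary.Construct.Closure.Symmetric using (fwd; bwd)
open import Relation.Binary.PropositionalEquality using (_≡_; _≢_; refl; sym; trans; cong; subst)
open import Relation.Nullary using (¬_; Dec; yes; no; ¬?; _×-dec_; _⊎-dec_; _→-dec_)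
import Relation.Nullary.Decidable as Dec

open RawSemiringDefs +-*-rawSemiring public using (_^_)

record ℝ : Set₁ where
  field
    L U         : ℚ → Set
    L-inhabited : ∃ L
    U-inhabited : ∃ U
    L-rounded   : ∀ p → L p ⇔ (∃ λ r → p < r × L r)
    U-rounded   : ∀ r → U r ⇔ (∃ λ p → p < r × U p)
    disjoint    : ∀ p → ¬ (L p × U p)
    located     : ∀ p r → p < r → L p ⊎ U r

infix 4 _≤ᴿ_ _<ᴿ_

_<ᴿ_ : ℝ → ℝ → Set
x <ᴿ y = ∃ λ r → ℝ.U x r × ℝ.L y r

_≤ᴿ_ : ℝ → ℝ → Set
x ≤ᴿ y = ∀ r → ℝ.L x r → ℝ.L y r

fromℚ : ℚ → ℝ
fromℚ w = record
  { L           = _< w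
  ; U           = w <_
  ; L-inhabited = w - 1ℚ , subst (w - 1ℚ <_) (ℚ.+-identityʳ w) (ℚ.+-monoʳ-< w (ℚ.negative⁻¹ (- 1ℚ)))
  ; U-inhabited = w + 1ℚ , subst (_< w + 1ℚ) (ℚ.+-identityʳ w) (ℚ.+-monoʳ-< w (ℚ.positive⁻¹ 1ℚ))
  ; L-rounded   = λ p → mk⇔ ℚ.<-dense (λ (_ , p<r , r<w) → ℚ.<-trans p<r r<w)
  ; U-rounded   = λ r → mk⇔ (λ w<r → let (p , w<p , p<r) = ℚ.<-dense w<r in p , p<r , w<p)
                             (λ (_ , p<r , w<p) → ℚ.<-trans w<p p<r)
  ; disjoint    = λ p (p<w , w<p) → ℚ.<-asym p<w w<p
  ; located     = loc
  }
  where
  loc : ∀ p r → p < r → p < w ⊎ w < r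
  loc p r p<r with p ℚ.<? w
  ... | yes p<w = inj₁ p<w
  ... | no  p≮w = inj₂ (ℚ.≤-<-trans (ℚ.≮⇒≥ p≮w) p<r)

infixl 6 _⊹_

private
  r+w-w : ∀ r w → (r + w) - w ≡ r
  r+w-w r w = trans (ℚ.+-assoc r w (- w)) (trans (cong (r +_) (ℚ.+-inverseʳ w)) (ℚ.+-identityʳ r))

  r-w+w : ∀ r w → (r - w) + w ≡ r
  r-w+w r w = trans (ℚ.+-assoc r (- w) w) (trans (cong (r +_) (ℚ.+-inverseˡ w)) (ℚ.+-identityʳ r))

  shift : ∀ {p r} w → p - w < r → p < r + w
  shift {p} {r} w lt = subst (_< r + w) (r-w+w p w) (ℚ.+-monoˡ-< w lt)

  unshift : ∀ {p r} w → p < r - w → p + w < r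
  unshift {p} {r} w lt = subst (p + w <_) (r-w+w r w) (ℚ.+-monoˡ-< w lt)

-- The sum of a rational and a real, obtained by translating the cut; the bound
-- T - π ≤ w with w rational is expressed as T ≤ᴿ w ⊹ π.
_⊹_ : ℚ → ℝ → ℝ
w ⊹ x = record
  { L           = λ r → L (r - w)
  ; U           = λ r → U (r - w)
  ; L-inhabited = let (r , Lr) = L-inhabited in r + w , subst L (sym (r+w-w r w)) Lr
  ; U-inhabited = let (r , Ur) = U-inhabited in r + w , subst U (sym (r+w-w r w)) Ur
  ; L-rounded   = λ p → mk⇔
      (λ Lp → let (r , p-w<r , Lr) = to (L-rounded _) Lp
              in r + w , shift w p-w<r , subst L (sym (r+w-w r w)) Lr)
      (λ (r , p<r , Lr) → from (L-rounded _) (r - w , ℚ.+-monoˡ-< (- w) p<r , Lr))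
  ; U-rounded   = λ r → mk⇔
      (λ Ur → let (p , p<r-w , Up) = to (U-rounded _) Ur
              in p + w , unshift w p<r-w , subst U (sym (r+w-w p w)) Up)
      (λ (p , p<r , Up) → from (U-rounded _) (p - w , ℚ.+-monoˡ-< (- w) p<r , Up))
  ; disjoint    = λ p → disjoint (p - w)
  ; located     = λ p r p<r → located (p - w) (r - w) (ℚ.+-monoˡ-< (- w) p<r)
  }
  where
  open ℝ x
  open Equivalence using (to; from)

-- Decides the equivalence relation generated by a finite list of pairs, adding
-- one pair at a time.
private
  module _ {X : Set} (_≟_ : Decidable {A = X} _≡_) where

    Gen : List (X × X) → Rel X 0ℓ
    Gen es = EqClosure (λ u v → (u , v) ∈ˡ es)

    Split : X → X → List (X × X) → Rel X 0ℓ
    Split a b es u v = Gen es u v ⊎ (Gen es u a × Gen es b v) ⊎ (Gen es u b × Gen es a v)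

    weaken : ∀ {e es u v} → Gen es u v → Gen (e ∷ es) u v
    weaken = EqC.map there

    unsplit : ∀ {a b es u v} → Split a b es u v → Gen ((a , b) ∷ es) u v
    unsplit (inj₁ p)              = weaken p
    unsplit (inj₂ (inj₁ (p , r))) = weaken p ◅◅ fwd (here refl) ◅ weaken r
    unsplit (inj₂ (inj₂ (p , r))) = weaken p ◅◅ bwd (here refl) ◅ weaken r

    extend : ∀ {a b es u v w} → Gen es u v → Split a b es v w → Split a b es u w
    extend p (inj₁ r)              = inj₁ (p ◅◅ r)
    extend p (inj₂ (inj₁ (r , s))) = inj₂ (inj₁ (p ◅◅ r , s))
    extend p (inj₂ (inj₂ (r , s))) = inj₂ (inj₂ (p ◅◅ r , s))

    crossF : ∀ {a b es v} → Split a b es b v → Split a b es a v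
    crossF (inj₁ p)              = inj₂ (inj₁ (ε , p))
    crossF (inj₂ (inj₁ (_ , p))) = inj₂ (inj₁ (ε , p))
    crossF (inj₂ (inj₂ (_ , p))) = inj₁ p

    crossB : ∀ {a b es v} → Split a b es a v → Split a b es b v
    crossB (inj₁ p)              = inj₂ (inj₂ (ε , p))
    crossB (inj₂ (inj₁ (_ , p))) = inj₁ p
    crossB (inj₂ (inj₂ (_ , p))) = inj₂ (inj₂ (ε , p))

    split : ∀ {a b es u v} → Gen ((a , b) ∷ es) u v → Split a b es u v
    split ε                     = inj₁ ε
    split (fwd (here refl) ◅ p) = crossF (split p)
    split (fwd (there x)   ◅ p) = extend (EqC.return x) (split p)
    split (bwd (here refl) ◅ p) = crossB (split p)
    split (bwd (there x)   ◅ p) = extend (bwd x ◅ ε) (split p)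

    gen? : ∀ es → Decidable (Gen es)
    gen? []             u v = Dec.map′ (λ { refl → ε }) empty (u ≟ v)
      where
      empty : ∀ {u v} → Gen [] u v → u ≡ v
      empty ε             = refl
      empty (fwd () ◅ _)
      empty (bwd () ◅ _)
    gen? ((a , b) ∷ es) u v = Dec.map′ unsplit split
      (gen? es u v ⊎-dec (gen? es u a ×-dec gen? es b v) ⊎-dec (gen? es u b ×-dec gen? es a v))

record Graph : Set where
  field
    #V #E : ℕ
    ends  : Fin #E → Fin #V × Fin #V

  V E : Set
  V = Fin #V
  E = Fin #E

  size : ℕ
  size = #V ℕ.+ #E

  -- Each pair (u , v) is ordered only by the arbitrary orientation in ends;
  -- EqClosure symmetrises it.
  Adjacent : Subset #E → Rel V 0ℓ
  Adjacent A u v = ∃ λ e → e ∈ A × ends e ≡ (u , v)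

  Connected : Subset #E → Rel V 0ℓ
  Connected A = EqClosure (Adjacent A)

  connected? : ∀ A → Decidable (Connected A)
  connected? A u v = Dec.map′ (EqC.map to) (EqC.map from) (gen? Fin._≟_ es u v)
    where
    es : List (V × V)
    es = map ends (filter (_∈? A) (allFin #E))

    to : ∀ {u v} → (u , v) ∈ˡ es → Adjacent A u v
    to uv∈es = let (e , e∈ , eq) = ∈-map⁻ ends uv∈es
               in e , proj₂ (∈-filter⁻ (_∈? A) {xs = allFin #E} e∈) , sym eq

    from : ∀ {u v} → Adjacent A u v → (u , v) ∈ˡ es
    from (e , e∈A , eq) = subst (_∈ˡ es) eq (∈-map⁺ ends (∈-filter⁺ (_∈? A) (∈-allFin e) e∈A))

  -- Components are counted by their least vertices.
  κ : Subset #E → ℕ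
  κ A = length (filter (λ v → Fin.all? (λ u → connected? A u v →-dec (v Fin.≤? u))) (allFin #V))

  Dart : Set
  Dart = E × Bool

  tail : Dart → V
  tail (e , false) = proj₁ (ends e)
  tail (e , true)  = proj₂ (ends e)

  reverse : Dart → Dart
  reverse (e , b) = e , not b

  Isolated : V → Set
  Isolated v = ∀ e → proj₁ (ends e) ≢ v × proj₂ (ends e) ≢ v

  isolated? : ∀ v → Dec (Isolated v)
  isolated? v = Fin.all? (λ e → ¬? (proj₁ (ends e) Fin.≟ v) ×-dec ¬? (proj₂ (ends e) Fin.≟ v))

  #isolated : ℕ
  #isolated = length (filter isolated? (allFin #V))

-- For a permutation of a finite set this is the relation of lying on a common cycle.
SameOrbit : {X : Set} → (X → X) → Rel X 0ℓ
SameOrbit f = EqClosure (λ x y → f x ≡ y)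

-- A plane embedding is given combinatorially by a rotation system: the cycles
-- of rot list the darts around each vertex, the cycles of rot ∘ reverse are the
-- facial walks. Each component is drawn on the sphere iff Euler's formula
-- V - E + F = 2 holds for it; as V - E + F ≤ 2 for every component, this is the
-- single equation below. An isolated vertex has one facial walk, without darts,
-- not counted by #F.
--
-- Outer selects the facial walks bounding the outer face. A component has at
-- most one such walk (none when it is nested in an inner face of another one),
-- and every such choice extends to a drawing in the plane.
record PlaneEmbedding (G : Graph) : Set₁ where
  open Graph G
  field
    rot        : Dart ↔ Dart
    rot-vertex : ∀ d d′ → tail d ≡ tail d′ ⇔ SameOrbit (Inverse.to rot) d d′
    #F         : ℕ
    face       : Dart → Fin #F
    face-onto  : Surjective _≡_ _≡_ face
    face-walk  : ∀ d d′ → face d ≡ face d′ ⇔ SameOrbit (Inverse.to rot ∘ reverse) d d′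
    euler      : #V ℕ.+ (#F ℕ.+ #isolated) ≡ #E ℕ.+ 2 ℕ.* κ ⊤
    Outer      : Fin #F → Set
    outer-uniq : ∀ d d′ → Outer (face d) → Outer (face d′) →
                 Connected ⊤ (tail d) (tail d′) → face d ≡ face d′

  OnOuterFace : V → Set
  OnOuterFace v = Isolated v ⊎ (∃ λ d → tail d ≡ v × Outer (face d))

record TwoTerminalPlanarGraph : Set₁ where
  field
    graph     : Graph
    embedding : PlaneEmbedding graph
  open Graph graph public
  open PlaneEmbedding embedding public
  field
    s t     : V
    s≢t     : s ≢ t
    s-outer : OnOuterFace s
    t-outer : OnOuterFace t

allSubsets : ∀ m → List (Subset m)
allSubsets zero    = [ [] ]
allSubsets (suc m) = map (outside ∷_) (allSubsets m) ++ map (inside ∷_) (allSubsets m)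

sumℚ productℚ : List ℚ → ℚ
sumℚ     = foldr _+_ 0ℚ
productℚ = foldr _*_ 1ℚ

module _ (q : ℚ) (Υ : TwoTerminalPlanarGraph) (ŵ : TwoTerminalPlanarGraph.E Υ → ℚ) where

  open TwoTerminalPlanarGraph Υ

  term : Subset #E → ℚ
  term A = productℚ (map ŵ (filter (_∈? A) (allFin #E))) * q ^ κ A

  Z-st : ℚ
  Z-st = sumℚ (map term (filter (λ A → connected? A s t) (allSubsets #E)))

  Z-s|t : ℚ
  Z-s|t = sumℚ (map term (filter (λ A → ¬? (connected? A s t)) (allSubsets #E)))

  Implements : ℚ → Set
  Implements w* = Σ (Z-s|t ≢ 0ℚ) λ Z≢0 → w* ≡ _÷_ (q * Z-st) Z-s|t {{≢-nonZero Z≢0}}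

-- A polynomial is its list of coefficients, constant term first. Coefficients
-- in ℕ suffice for upper bounds at non-negative arguments.
evalPoly : List ℕ → ℕ → ℕ
evalPoly cs x = foldr (λ c y → c ℕ.+ x ℕ.* y) 0 cs

-- N ≤ p(⌈log₂ π⁻¹⌉) for 0 < π ≤ 1: the n with ½ ^ n ≤ π are those with
-- log₂ π⁻¹ ≤ n, and evalPoly p is monotone, so the least such n gives the bound.
_≤poly_[log_⁻¹] : ℕ → List ℕ → ℝ → Set
N ≤poly p [log π ⁻¹] = ∀ n → fromℚ (ℚ.½ ^ n) ≤ᴿ π → N ℕ.≤ evalPoly p n

{-# OPTIONS --safe #-}

-- With y = 1 + α₁ we have y² > 1, so 2k parallel edges of weight α₁ implement
-- the weight v_k = y²ᵏ - 1 > 0, which grows exponentially in k. In series,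
-- weights multiply through w ↦ 1 + q / w, so bundles k₁, k₂, … in series
-- implement the w* with 1 + q / w* = ∏ (1 + q / v_{kᵢ}). The factors tend to 1
-- exponentially fast, each being at most a bounded power of the next one, so
-- 1 + q / T is approached greedily from below: for k = 1, …, K take boundedly
-- many factors of index k, and one last factor of index K oversteps the target.
-- This uses O(K²) edges and reaches precision O(1 / v_K). All inequalities are
-- kept free of division, through the products ∏ v_k and ∏ (q + v_k).
module Submission where

open import Defs
open import Data.Bool.Base using (Bool; true; false; _∨_)
open import Data.Fin.Base as Fin using (Fin; zero; suc; fromℕ)
import Data.Fin.Properties as Fin
open import Data.Fin.Subset using (Subset; inside; outside; ⊤; ∣_∣)
open import Data.Fin.Subset.Properties using (_∈?_; drop-there)
open import Data.Integer.Base as ℤ using (-[1+_])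
import Data.Integer.Properties as ℤ
open import Data.List.Base using (List; []; _∷_; _++_; map; filter; length; tabulate; allFin)
open import Data.List.Properties using (filter-accept; filter-reject; filter-none; map-++; map-∘; map-cong; length-map)
open import Data.List.Relation.Unary.All as All using (All; []; _∷_)
import Data.List.Relation.Unary.All.Properties as All
open import Data.Nat.Base as ℕ using (ℕ; zero; suc; z≤n; s≤s)
import Data.Nat.Properties as ℕ
open import Data.Nat.Tactic.RingSolver using (solve-∀)
open import Data.Product.Base as Product using (Σ; ∃; ∃₂; _×_; _,_; proj₁; proj₂)
open import Data.Rational.Base as ℚ using (ℚ; mkℚ; 0ℚ; 1ℚ; ½; _+_; _*_; _-_; -_; _<_; _≤_; _/_; _÷_; ≢-nonZero; toℚᵘ)
import Data.Rational.Properties as ℚ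
open import Data.Rational.Solver using (module +-*-Solver)
import Data.Rational.Unnormalised.Base as ℚᵘ
import Data.Rational.Unnormalised.Properties as ℚᵘ
open import Data.Sum.Base using (_⊎_; inj₁; inj₂; [_,_]′)
open import Data.Vec.Base using ([]; _∷_; here; there)
open import Function.Base using (_∘_; id)
open import Function.Bundles using (_⇔_; mk⇔; Equivalence; _↔_; mk↔ₛ′; Inverse)
open import Function.Construct.Composition using (_↔-∘_)
open import Function.Construct.Identity using (↔-id)
import Relation.Binary.Construct.Closure.Equivalence as EqC
open import Relation.Binary.Construct.Closure.ReflexiveTransitive using (ε; _◅_; _◅◅_)
open import Relation.Binary.Construct.Closure.Symmetric using (fwd; bwd)
open import Relation.Binary.Definitions using (tri<; tri≈; tri>)
open import Relation.Binary.PropositionalEquality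
open import Relation.Nullary using (¬_; yes; no; contradiction; ¬?; _→-dec_)
open import Relation.Nullary.Decidable using (from-no)
open import Relation.Unary using (Pred; Decidable)

open +-*-Solver using (solve; _:=_; _:+_; _:*_; _:-_; con)
open Graph using (tail; reverse; Adjacent; Connected; connected?; κ)
open ℝ

-- Comparison with a real number is not decidable, so the greedy search cannot run on `T*` itself.
-- It runs on a rational `T` just below, where every test is a decidable rational inequality, and
-- half of the tolerance pays for the replacement. The constants of the search come from one
-- rational below `T⁻` and one above `T⁺`, which makes the size bound uniform in the target. On the
-- graph side, chains are generated one edge at a time, always at the first vertex. Rotation system,
-- faces, connectivity and partition sums can then all be computed by induction along this
-- construction; planarity in particular becomes a matter of tracking how one new edge changes the
-- orbits of two permutations.

private variable
  m n : ℕ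
  X   : Set

-- Rational inequalities

infixl 7 _⊛_ _⊛⁺_
infixl 6 _⊕_ _⊕⁺_

_⊛_ : ∀ {x y} → 0ℚ ≤ x → 0ℚ ≤ y → 0ℚ ≤ x * y
_⊛_ {x} {y} x≥0 y≥0 = ℚ.nonNegative⁻¹ (x * y) {{ℚ.nonNeg*nonNeg⇒nonNeg x {{ℚ.nonNegative x≥0}} y {{ℚ.nonNegative y≥0}}}}

_⊕_ : ∀ {x y} → 0ℚ ≤ x → 0ℚ ≤ y → 0ℚ ≤ x + y
_⊕_ = ℚ.+-mono-≤

_⊛⁺_ : ∀ {x y} → 0ℚ < x → 0ℚ < y → 0ℚ < x * y
_⊛⁺_ {x} {y} x>0 y>0 = ℚ.positive⁻¹ (x * y) {{ℚ.pos*pos⇒pos x {{ℚ.positive x>0}} y {{ℚ.positive y>0}}}}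

_⊕⁺_ : ∀ {x y} → 0ℚ < x → 0ℚ < y → 0ℚ < x + y
_⊕⁺_ = ℚ.+-mono-<

0≤1 : 0ℚ ≤ 1ℚ
0≤1 = ℚ.nonNegative⁻¹ 1ℚ

0<½ : 0ℚ < ½
0<½ = ℚ.positive⁻¹ ½

gap≥0 : ∀ {x y} → x ≤ y → 0ℚ ≤ y - x
gap≥0 {x} {y} x≤y = subst (_≤ y - x) (ℚ.+-inverseʳ x) (ℚ.+-monoˡ-≤ (- x) x≤y)

gap>0 : ∀ {x y} → x < y → 0ℚ < y - x
gap>0 {x} {y} x<y = subst (_< y - x) (ℚ.+-inverseʳ x) (ℚ.+-monoˡ-< (- x) x<y)

≤-by : ∀ {x y d} → 0ℚ ≤ d → y ≡ x + d → x ≤ y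
≤-by {x} {y} {d} d≥0 eq = subst₂ _≤_ (ℚ.+-identityʳ x) (sym eq) (ℚ.+-monoʳ-≤ x d≥0)

<-by : ∀ {x y d} → 0ℚ < d → y ≡ x + d → x < y
<-by {x} {y} {d} d>0 eq = subst₂ _<_ (ℚ.+-identityʳ x) (sym eq) (ℚ.+-monoʳ-< x d>0)

cancel-≤ : ∀ r {x y} → 0ℚ < r → r * x ≤ r * y → x ≤ y
cancel-≤ r r>0 = ℚ.*-cancelˡ-≤-pos r {{ℚ.positive r>0}}

cancel-< : ∀ r {x y} → 0ℚ < r → r * x < r * y → x < y
cancel-< r r>0 = ℚ.*-cancelˡ-<-nonNeg r {{ℚ.pos⇒nonNeg r {{ℚ.positive r>0}}}}

-- Recursive, so that `⟦ suc n ⟧` unfolds to `1ℚ + ⟦ n ⟧` and the ring solver can treat successors.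
⟦_⟧ : ℕ → ℚ
⟦ zero ⟧  = 0ℚ
⟦ suc n ⟧ = 1ℚ + ⟦ n ⟧

⟦⟧≥0 : ∀ n → 0ℚ ≤ ⟦ n ⟧
⟦⟧≥0 zero    = ℚ.≤-refl
⟦⟧≥0 (suc n) = 0≤1 ⊕ ⟦⟧≥0 n

toℚᵘ-⟦⟧ : ∀ n → toℚᵘ ⟦ n ⟧ ℚᵘ.≃ ℚᵘ.mkℚᵘ (ℤ.+ n) 0
toℚᵘ-⟦⟧ zero    = ℚᵘ.≃-refl
toℚᵘ-⟦⟧ (suc n) = ℚᵘ.≃-trans (ℚ.toℚᵘ-homo-+ 1ℚ ⟦ n ⟧)
  (ℚᵘ.≃-trans (ℚᵘ.+-congʳ (toℚᵘ 1ℚ) (toℚᵘ-⟦⟧ n))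
    (ℚᵘ.*≡* (cong (ℤ._* (ℤ.+ 1)) (cong ℤ.suc (ℤ.*-identityʳ (ℤ.+ n))))))

⟦⟧-unbounded : ∀ x → ∃ λ n → x ≤ ⟦ n ⟧
⟦⟧-unbounded x@(mkℚ p d _) = ℤ.∣ p ∣ , ℚ.toℚᵘ-cancel-≤ (ℚᵘ.≤-respʳ-≃ (ℚᵘ.≃-sym (toℚᵘ-⟦⟧ ℤ.∣ p ∣))
  (ℚᵘ.*≤* (bound p)))
  where
  bound : ∀ p → p ℤ.* ℤ.+ 1 ℤ.≤ ℤ.+ ℤ.∣ p ∣ ℤ.* ℤ.+ suc d
  bound (ℤ.+ n)    rewrite ℤ.*-identityʳ (ℤ.+ n) | sym (ℤ.pos-* n (suc d)) = ℤ.+≤+ (ℕ.m≤m*n n (suc d))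
  bound -[1+ n ] = ℤ.-≤+

⟦⟧-multiples-unbounded : ∀ r → 0ℚ < r → ∀ x → ∃ λ n → x ≤ ⟦ n ⟧ * r
⟦⟧-multiples-unbounded r r>0 x =
  let instance _ = ℚ.positive r>0; _ = ℚ.pos⇒nonZero r
      n , bound = ⟦⟧-unbounded (x * ℚ.1/ r)
  in n , subst (_≤ ⟦ n ⟧ * r)
           (trans (ℚ.*-assoc x (ℚ.1/ r) r) (trans (cong (x *_) (ℚ.*-inverseˡ r)) (ℚ.*-identityʳ x)))
           (ℚ.*-monoʳ-≤-nonNeg r {{ℚ.pos⇒nonNeg r}} bound)

½^>0 : ∀ n → 0ℚ < ½ ^ n
½^>0 zero    = ℚ.positive⁻¹ 1ℚ
½^>0 (suc n) = 0<½ ⊛⁺ ½^>0 n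

½^-halves : ∀ n → ½ ^ n ≡ ½ ^ suc n + ½ ^ suc n
½^-halves n = solve 1 (λ x → x := con ½ :* x :+ con ½ :* x) refl (½ ^ n)

½^-suc : ∀ n → ½ ^ suc n < ½ ^ n
½^-suc n = <-by (½^>0 (suc n)) (½^-halves n)

½^-antitone : ∀ {m n} → m ℕ.≤′ n → ½ ^ n ≤ ½ ^ m
½^-antitone ℕ.≤′-refl       = ℚ.≤-refl
½^-antitone {n = suc n} (ℕ.≤′-step m≤n) = ℚ.≤-trans (ℚ.<⇒≤ (½^-suc n)) (½^-antitone m≤n)

-- Some `n` has `n r ≥ 1`. Together with `n / 2ⁿ ≤ 1` (`below`) this gives `1 / 2ⁿ ≤ r`.
½^-small : ∀ r → 0ℚ < r → ∃ λ n → ½ ^ n ≤ r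
½^-small r r>0 =
  let n , 1≤nr = ⟦⟧-multiples-unbounded r r>0 1ℚ
  in n , ℚ.≤-trans (scaled n) (ℚ.≤-trans (ℚ.*-monoʳ-≤-nonNeg (½ ^ n) {{ℚ.nonNegative (ℚ.<⇒≤ (½^>0 n))}} 1≤nr)
       (≤-by ((gap≥0 (below n)) ⊛ ℚ.<⇒≤ r>0)
          (solve 3 (λ c r e → r := c :* r :* e :+ (con 1ℚ :- c :* e) :* r) refl ⟦ n ⟧ r (½ ^ n))))
  where
  scaled : ∀ n → ½ ^ n ≤ 1ℚ * ½ ^ n
  scaled n = ℚ.≤-reflexive (sym (ℚ.*-identityˡ (½ ^ n)))

  below : ∀ n → ⟦ n ⟧ * ½ ^ n ≤ 1ℚ
  below zero    = 0≤1
  below (suc n) = ≤-by ((gap≥0 (below n) ⊛ ℚ.<⇒≤ 0<½) ⊕ (gap≥0 (½^-antitone {0} (ℕ.z≤′n {n})) ⊛ ℚ.<⇒≤ 0<½))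
    (solve 2 (λ c e → con 1ℚ := (con 1ℚ :+ c) :* (con ½ :* e) :+ ((con 1ℚ :- c :* e) :* con ½ :+ (con 1ℚ :- e) :* con ½)) refl ⟦ n ⟧ (½ ^ n))

-- Rational approximation of cuts

L-down : ∀ x {p r} → p ≤ r → L x r → L x p
L-down x {p} {r} p≤r Lr with ℚ.<-cmp p r
... | tri< p<r _ _ = Equivalence.from (L-rounded x p) (r , p<r , Lr)
... | tri≈ _ refl _ = Lr
... | tri> _ _ r<p = contradiction (ℚ.<-≤-trans r<p p≤r) (ℚ.<-irrefl refl)

L<U : ∀ x {p r} → L x p → U x r → p < r
L<U x {p} {r} Lp Ur with p ℚ.<? r
... | yes p<r = p<r
... | no p≮r  = contradiction (L-down x (ℚ.≮⇒≥ p≮r) Lp , Ur) (disjoint x r)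

-- `_≤ᴿ_` speaks of lower cuts only; locatedness transfers it to upper cuts at the price of
-- enlarging `r`.
≤ᴿ⇒U : ∀ x y {r r′} → x ≤ᴿ y → r < r′ → U y r → U x r′
≤ᴿ⇒U x y {r} {r′} x≤y r<r′ Ur with located x r r′ r<r′
... | inj₁ Lr  = contradiction (x≤y r Lr , Ur) (disjoint y r)
... | inj₂ Ur′ = Ur′

dyadic-below : ∀ x → fromℚ 0ℚ <ᴿ x → ∃ λ m → L x (½ ^ m) × (∀ n → fromℚ (½ ^ n) ≤ᴿ x → m ℕ.≤ 2 ℕ.+ n)
dyadic-below x (r , 0<r , Lr) = let m , small = ½^-small r 0<r in search m (L-down x small Lr)
  where
  search : ∀ m → L x (½ ^ m) → ∃ λ m → L x (½ ^ m) × (∀ n → fromℚ (½ ^ n) ≤ᴿ x → m ℕ.≤ 2 ℕ.+ n)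
  search 0             Lm = 0 , Lm , λ _ _ → z≤n
  search 1             Lm = 1 , Lm , λ _ _ → s≤s z≤n
  search (suc (suc m)) Lm = [ search (suc m) , stop ]′ (located x (½ ^ suc m) (½ ^ m) (½^-suc m))
    where
    stop : U x (½ ^ m) → ∃ λ m → L x (½ ^ m) × (∀ n → fromℚ (½ ^ n) ≤ᴿ x → m ℕ.≤ 2 ℕ.+ n)
    stop Um = suc (suc m) , Lm , λ n ½^n≤x → s≤s (s≤s (ℕ.≮⇒≥ λ n<m → contradiction
      (½^n≤x (½ ^ m) (ℚ.≤-<-trans (½^-antitone (ℕ.≤⇒≤′ n<m)) (½^-suc n)) , Um) (disjoint x (½ ^ m))))

-- A walk upwards from `a` in steps of `η / 2`: locatedness between `r + η / 2` and `r + η` permits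
-- another step or certifies the upper bound. The fuel `n` would carry the walk past `b`, which lies
-- in the upper cut.
rational-below : ∀ x {a η} → 0ℚ < η → L x a → ∃ λ r → a ≤ r × L x r × U x (r + η)
rational-below x {a} {η} η>0 La =
  let n , enough = ⟦⟧-multiples-unbounded (½ * η) (0<½ ⊛⁺ η>0) (b - a)
  in search n a ℚ.≤-refl La (transpose enough)
  where
  b = proj₁ (U-inhabited x)
  η½>0 = 0<½ ⊛⁺ η>0

  transpose : ∀ {a b c} → b - a ≤ c → b ≤ a + c
  transpose {a} {b} {c} b-a≤c = ≤-by (gap≥0 b-a≤c)
    (solve 3 (λ a b c → a :+ c := b :+ (c :- (b :- a))) refl a b c)

  search : ∀ n r → a ≤ r → L x r → b ≤ r + ⟦ n ⟧ * (½ * η) → ∃ λ r → a ≤ r × L x r × U x (r + η)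
  search zero    r a≤r Lr enough = contradiction
    (L-down x (ℚ.≤-trans enough (ℚ.≤-reflexive (solve 2 (λ r h → r :+ con 0ℚ :* h := r) refl r (½ * η)))) Lr
    , proj₂ (U-inhabited x)) (disjoint x b)
  search (suc n) r a≤r Lr enough = [ continue , (λ Ur → r , a≤r , Lr , Ur) ]′
    (located x (r + ½ * η) (r + η) (<-by η½>0 (solve 2 (λ r h → r :+ h := r :+ con ½ :* h :+ con ½ :* h) refl r η)))
    where
    continue : L x (r + ½ * η) → ∃ λ r → a ≤ r × L x r × U x (r + η)
    continue Lr′ = search n (r + ½ * η) (ℚ.≤-trans a≤r (≤-by (ℚ.<⇒≤ η½>0) refl)) Lr′
      (ℚ.≤-trans enough (ℚ.≤-reflexive
        (solve 3 (λ r c h → r :+ (con 1ℚ :+ c) :* h := r :+ h :+ c :* h) refl r ⟦ n ⟧ (½ * η))))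

-- Chains of bundles and their plane embeddings

-- Chain m n is a path on n + 2 vertices whose m + 1 edges are bundled in parallel.
data Chain : ℕ → ℕ → Set where
  edge : Chain 0 0
  par  : ∀ {m n} → Chain m n → Chain (suc m) n
  ser  : ∀ {m n} → Chain m n → Chain (suc m) (suc n)

-- The newest edge has number zero and joins the first two vertices, so the head of an edge subset
-- always concerns the newest edge.
chainEnds : Chain m n → Fin (suc m) → Fin (suc (suc n)) × Fin (suc (suc n))
chainEnds c       zero     = zero , suc zero
chainEnds edge    (suc ())
chainEnds (par c) (suc e)  = chainEnds c e
chainEnds (ser c) (suc e)  = Product.map suc suc (chainEnds c e)

chain : Chain m n → Graph
chain {m} {n} c = record { #V = suc (suc n) ; #E = suc m ; ends = chainEnds c }

CDart : ℕ → Set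
CDart m = Fin (suc m) × Bool

old : CDart m → CDart (suc m)
old = Product.map₁ suc

lift : (CDart m → CDart m) → CDart (suc m) → CDart (suc m)
lift f (zero  , b) = zero , b
lift f (suc e , b) = old (f (e , b))

lift-inverse : ∀ {f g : CDart m → CDart m} → (∀ d → f (g d) ≡ d) → ∀ d → lift f (lift g d) ≡ d
lift-inverse fg (zero  , b) = refl
lift-inverse fg (suc e , b) = cong old (fg (e , b))

lift↔ : CDart m ↔ CDart m → CDart (suc m) ↔ CDart (suc m)
lift↔ r = mk↔ₛ′ (lift to) (lift from) (lift-inverse strictlyInverseˡ) (lift-inverse strictlyInverseʳ)
  where open Inverse r

swapTails swapHeads swapMiddle : CDart (suc m) → CDart (suc m)

swapTails (zero     , false) = suc zero , false
swapTails (suc zero , false) = zero , false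
swapTails d                  = d

swapHeads (zero     , true) = suc zero , true
swapHeads (suc zero , true) = zero , true
swapHeads d                 = d

swapMiddle (zero     , true)  = suc zero , false
swapMiddle (suc zero , false) = zero , true
swapMiddle d                  = d

swapTails-involutive : ∀ (d : CDart (suc m)) → swapTails (swapTails d) ≡ d
swapTails-involutive (zero        , false) = refl
swapTails-involutive (zero        , true)  = refl
swapTails-involutive (suc zero    , false) = refl
swapTails-involutive (suc zero    , true)  = refl
swapTails-involutive (suc (suc e) , b)     = refl

swapHeads-involutive : ∀ (d : CDart (suc m)) → swapHeads (swapHeads d) ≡ d
swapHeads-involutive (zero        , false) = refl
swapHeads-involutive (zero        , true)  = refl
swapHeads-involutive (suc zero    , false) = refl
swapHeads-involutive (suc zero    , true)  = refl
swapHeads-involutive (suc (suc e) , b)     = refl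

swapMiddle-involutive : ∀ (d : CDart (suc m)) → swapMiddle (swapMiddle d) ≡ d
swapMiddle-involutive (zero        , false) = refl
swapMiddle-involutive (zero        , true)  = refl
swapMiddle-involutive (suc zero    , false) = refl
swapMiddle-involutive (suc zero    , true)  = refl
swapMiddle-involutive (suc (suc e) , b)     = refl

involution : (f : CDart m → CDart m) → (∀ d → f (f d) ≡ d) → CDart m ↔ CDart m
involution f ff = mk↔ₛ′ f f ff ff

-- Multiplying a permutation by a transposition inserts a fixed point into a
-- cycle: a parallel edge is drawn just below the first edge, and a new first
-- vertex is attached just before the dart (suc zero , false).
rotation : Chain m n → CDart m ↔ CDart m
rotation edge    = ↔-id _
rotation (par c) = involution swapTails swapTails-involutive
             ↔-∘ (lift↔ (rotation c) ↔-∘ involution swapHeads swapHeads-involutive)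
rotation (ser c) = involution swapMiddle swapMiddle-involutive ↔-∘ lift↔ (rotation c)

rotate : Chain m n → CDart m → CDart m
rotate c = Inverse.to (rotation c)

source : Chain m n → CDart m → Fin (suc (suc n))
source c = tail (chain c)

source-par : ∀ (c : Chain m n) d → source (par c) (old d) ≡ source c d
source-par c (e , false) = refl
source-par c (e , true)  = refl

source-ser : ∀ (c : Chain m n) d → source (ser c) (old d) ≡ suc (source c d)
source-ser c (e , false) = refl
source-ser c (e , true)  = refl

source-swapTails : ∀ (c : Chain m n) d → source (par c) (swapTails d) ≡ source (par c) d
source-swapTails c (zero        , false) = refl
source-swapTails c (zero        , true)  = refl
source-swapTails c (suc zero    , false) = refl
source-swapTails c (suc zero    , true)  = refl
source-swapTails c (suc (suc e) , b)     = refl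

source-swapHeads : ∀ (c : Chain m n) d → source (par c) (swapHeads d) ≡ source (par c) d
source-swapHeads c (zero        , false) = refl
source-swapHeads c (zero        , true)  = refl
source-swapHeads c (suc zero    , false) = refl
source-swapHeads c (suc zero    , true)  = refl
source-swapHeads c (suc (suc e) , b)     = refl

source-swapMiddle : ∀ (c : Chain m n) d → source (ser c) (swapMiddle d) ≡ source (ser c) d
source-swapMiddle c (zero        , false) = refl
source-swapMiddle c (zero        , true)  = refl
source-swapMiddle c (suc zero    , false) = refl
source-swapMiddle c (suc zero    , true)  = refl
source-swapMiddle c (suc (suc e) , b)     = refl

source-rotate : ∀ (c : Chain m n) d → source c (rotate c d) ≡ source c d
source-rotate edge    d = refl
source-rotate (par c) d = trans (source-swapTails c (lift (rotate c) (swapHeads d)))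
                         (trans (lifted (swapHeads d)) (source-swapHeads c d))
  where
  lifted : ∀ d → source (par c) (lift (rotate c) d) ≡ source (par c) d
  lifted (zero  , b) = refl
  lifted (suc e , b) = trans (source-par c (rotate c (e , b))) (trans (source-rotate c (e , b)) (sym (source-par c (e , b))))
source-rotate (ser c) d = trans (source-swapMiddle c (lift (rotate c) d)) (lifted d)
  where
  lifted : ∀ d → source (ser c) (lift (rotate c) d) ≡ source (ser c) d
  lifted (zero  , b) = refl
  lifted (suc e , b) = trans (source-ser c (rotate c (e , b)))
                      (trans (cong suc (source-rotate c (e , b))) (sym (source-ser c (e , b))))

dartAt : Chain m n → Fin (suc (suc n)) → CDart m
dartAt edge    zero       = zero , false
dartAt edge    (suc zero) = zero , true
dartAt (par c) v          = old (dartAt c v)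
dartAt (ser c) zero       = zero , false
dartAt (ser c) (suc v)    = old (dartAt c v)

source-dartAt : ∀ (c : Chain m n) v → source c (dartAt c v) ≡ v
source-dartAt edge    zero       = refl
source-dartAt edge    (suc zero) = refl
source-dartAt (par c) v          = trans (source-par c (dartAt c v)) (source-dartAt c v)
source-dartAt (ser c) zero       = refl
source-dartAt (ser c) (suc v)    = trans (source-ser c (dartAt c v)) (cong suc (source-dartAt c v))

orbit-map : ∀ {X Y : Set} {f : X → X} {g : Y → Y} (h : X → Y) →
            (∀ x → SameOrbit g (h x) (h (f x))) → ∀ {x y} → SameOrbit f x y → SameOrbit g (h x) (h y)
orbit-map h step = EqC.gfold (EqC.isEquivalence _) h (λ { {x} refl → step x })

next : ∀ {X : Set} {f : X → X} {x} → SameOrbit f x (f x)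
next = fwd refl ◅ ε

SameVertex : Chain m n → CDart m → CDart m → Set
SameVertex c = SameOrbit (rotate c)

-- Old orbits survive the surgery: a step of `rotate c` may now make a detour through an inserted
-- dart, and `untwist` completes the detour.
orbit-dartAt : ∀ (c : Chain m n) d → SameVertex c d (dartAt c (source c d))
orbit-dartAt edge (zero , false) = ε
orbit-dartAt edge (zero , true)  = ε
orbit-dartAt {suc m} (par c) d = at d
  where
  untwist : ∀ d → SameVertex (par c) (swapTails (old d)) (old d)
  untwist (zero  , false) = next
  untwist (zero  , true)  = ε
  untwist (suc e , b)     = ε

  step : ∀ d → SameVertex (par c) (old d) (old (rotate c d))
  step (zero  , false) = next ◅◅ untwist (rotate c (zero , false))
  step (zero  , true)  = next ◅◅ next ◅◅ untwist (rotate c (zero , true))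
  step (suc e , b)     = next ◅◅ untwist (rotate c (suc e , b))

  at-old : ∀ d → SameVertex (par c) (old d) (dartAt (par c) (source c d))
  at-old d = orbit-map old step (orbit-dartAt c d)

  at : ∀ d → SameVertex (par c) d (dartAt (par c) (source (par c) d))
  at (zero  , false) = next ◅◅ at-old (zero , false)
  at (zero  , true)  = bwd refl ◅ at-old (zero , true)
  at (suc e , false) = at-old (e , false)
  at (suc e , true)  = at-old (e , true)
orbit-dartAt {suc m} (ser c) d = at d
  where
  untwist : ∀ d → SameVertex (ser c) (swapMiddle (old d)) (old d)
  untwist (zero  , false) = next
  untwist (zero  , true)  = ε
  untwist (suc e , b)     = ε

  step : ∀ d → SameVertex (ser c) (old d) (old (rotate c d))
  step (e , b) = next ◅◅ untwist (rotate c (e , b))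

  at-old : ∀ d → SameVertex (ser c) (old d) (dartAt (ser c) (suc (source c d)))
  at-old d = orbit-map old step (orbit-dartAt c d)

  at : ∀ d → SameVertex (ser c) d (dartAt (ser c) (source (ser c) d))
  at (zero  , false) = ε
  at (zero  , true)  = next ◅◅ at-old (zero , false)
  at (suc e , false) = at-old (e , false)
  at (suc e , true)  = at-old (e , true)

-- The number of inner faces: only a parallel edge closes a new one.
#par : Chain m n → ℕ
#par edge    = 0
#par (par c) = suc (#par c)
#par (ser c) = #par c

-- A parallel edge cuts off a digon, numbered zero.
faceOf : (c : Chain m n) → CDart m → Fin (suc (#par c))
faceOf edge    _                     = zero
faceOf (par c) (zero        , false) = suc (faceOf c (zero , false))
faceOf (par c) (zero        , true)  = zero
faceOf (par c) (suc zero    , false) = zero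
faceOf (par c) (suc zero    , true)  = suc (faceOf c (zero , true))
faceOf (par c) (suc (suc e) , b)     = suc (faceOf c (suc e , b))
faceOf (ser c) (zero  , b)           = faceOf c (zero , false)
faceOf (ser c) (suc e , b)           = faceOf c (e , b)

-- The new edge takes over the side `(zero , false)` of the old first edge. Hence `swapTails ∘ old`
-- carries the old facial walks over, and the two darts outside its image bound the digon.
faceOf-par : ∀ (c : Chain m n) d → faceOf (par c) (swapTails (old d)) ≡ suc (faceOf c d)
faceOf-par c (zero  , false) = refl
faceOf-par c (zero  , true)  = refl
faceOf-par c (suc e , b)     = refl

faceOf-ser : ∀ (c : Chain m n) d → faceOf (ser c) (swapMiddle (old d)) ≡ faceOf c d
faceOf-ser c (zero  , false) = refl
faceOf-ser c (zero  , true)  = refl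
faceOf-ser c (suc e , b)     = refl

walk : Chain m n → CDart m → CDart m
walk c = rotate c ∘ reverse (chain c)

faceOf-walk : ∀ (c : Chain m n) d → faceOf c (walk c d) ≡ faceOf c d
faceOf-walk edge d = refl
faceOf-walk (par c) (zero        , false) = trans (faceOf-par c (walk c (zero , false))) (cong suc (faceOf-walk c (zero , false)))
faceOf-walk (par c) (zero        , true)  = refl
faceOf-walk (par c) (suc zero    , false) = refl
faceOf-walk (par c) (suc zero    , true)  = trans (faceOf-par c (walk c (zero , true))) (cong suc (faceOf-walk c (zero , true)))
faceOf-walk (par c) (suc (suc e) , b)     = trans (faceOf-par c (walk c (suc e , b))) (cong suc (faceOf-walk c (suc e , b)))
faceOf-walk (ser c) (zero  , false) = refl
faceOf-walk (ser c) (zero  , true)  = refl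
faceOf-walk (ser c) (suc e , b)     = trans (faceOf-ser c (walk c (e , b))) (faceOf-walk c (e , b))

dartOn : (c : Chain m n) → Fin (suc (#par c)) → CDart m
dartOn edge    _       = zero , false
dartOn (par c) zero    = suc zero , false
dartOn (par c) (suc f) = swapTails (old (dartOn c f))
dartOn (ser c) f       = old (dartOn c f)

faceOf-dartOn : ∀ (c : Chain m n) f → faceOf c (dartOn c f) ≡ f
faceOf-dartOn edge    zero    = refl
faceOf-dartOn (par c) zero    = refl
faceOf-dartOn (par c) (suc f) = trans (faceOf-par c (dartOn c f)) (cong suc (faceOf-dartOn c f))
faceOf-dartOn (ser c) f       = faceOf-dartOn c f

SameFace : Chain m n → CDart m → CDart m → Set
SameFace c = SameOrbit (walk c)

orbit-dartOn : ∀ (c : Chain m n) d → SameFace c d (dartOn c (faceOf c d))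
orbit-dartOn edge (zero , false) = ε
orbit-dartOn edge (zero , true)  = next
orbit-dartOn {suc m} (par c) d = on d
  where
  step : ∀ d → SameFace (par c) (swapTails (old d)) (swapTails (old (walk c d)))
  step (zero  , false) = next
  step (zero  , true)  = next
  step (suc e , b)     = next

  on-old : ∀ d → SameFace (par c) (swapTails (old d)) (dartOn (par c) (suc (faceOf c d)))
  on-old d = orbit-map (swapTails ∘ old) step (orbit-dartOn c d)

  on : ∀ d → SameFace (par c) d (dartOn (par c) (faceOf (par c) d))
  on (zero        , false) = on-old (zero , false)
  on (zero        , true)  = next
  on (suc zero    , false) = ε
  on (suc zero    , true)  = on-old (zero , true)
  on (suc (suc e) , b)     = on-old (suc e , b)
orbit-dartOn {suc m} (ser c) d = on d
  where
  -- The new edge is pendant, so a walk arriving at its attachment goes along one side of it and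
  -- back along the other.
  untwist : ∀ d → SameFace (ser c) (swapMiddle (old d)) (old d)
  untwist (zero  , false) = next ◅◅ next
  untwist (zero  , true)  = ε
  untwist (suc e , b)     = ε

  step : ∀ d → SameFace (ser c) (old d) (old (walk c d))
  step d = next ◅◅ untwist (walk c d)

  on-old : ∀ d → SameFace (ser c) (old d) (dartOn (ser c) (faceOf c d))
  on-old d = orbit-map old step (orbit-dartOn c d)

  on : ∀ d → SameFace (ser c) d (dartOn (ser c) (faceOf (ser c) d))
  on (zero  , false) = next ◅◅ on-old (zero , false)
  on (zero  , true)  = next ◅◅ next ◅◅ on-old (zero , false)
  on (suc e , b)     = on-old (e , b)

-- Used for vertices and for faces: points with equal labels are joined through the representative
-- of that label.
label⇔orbit : ∀ {X L : Set} {f : X → X} (ℓ : X → L) (rep : L → X) →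
              (∀ x → ℓ (f x) ≡ ℓ x) → (∀ x → SameOrbit f x (rep (ℓ x))) →
              ∀ x y → ℓ x ≡ ℓ y ⇔ SameOrbit f x y
label⇔orbit {f = f} ℓ rep constant joined x y = mk⇔
  (λ eq → joined x ◅◅ subst (λ l → SameOrbit f (rep l) y) (sym eq) (EqC.symmetric _ (joined y)))
  (EqC.gfold isEquivalence ℓ (λ { {z} refl → sym (constant z) }))

-- Puts `t` on the face of `(zero , false)`, the outer face, which `s` meets by definition. In the
-- parallel case `(zero , false)` itself cannot be the far dart, as its source is the first vertex.
farDart : (c : Chain m n) → ∃ λ d → source c d ≡ fromℕ (suc n) × faceOf c d ≡ faceOf c (zero , false)
farDart edge    = (zero , true) , refl , refl
farDart (par c) with farDart c
... | (zero  , true)  , v , f = (suc zero , true) , v , cong suc f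
... | (suc e , false) , v , f = (suc (suc e) , false) , v , cong suc f
... | (suc e , true)  , v , f = (suc (suc e) , true) , v , cong suc f
farDart (ser c) with farDart c
... | d , v , f = old d , trans (source-ser c d) (cong suc v) , f

#edges : (c : Chain m n) → m ≡ n ℕ.+ #par c
#edges edge            = refl
#edges {n = n} (par c) = trans (cong suc (#edges c)) (sym (ℕ.+-suc n (#par c)))
#edges (ser c)         = cong suc (#edges c)

-- Connectivity in chains

Joined : Chain m n → Subset (suc m) → Fin (suc (suc n)) → Fin (suc (suc n)) → Set
Joined c = Connected (chain c)

-- For connectivity, two parallel edges act as one that is present as soon as either is; hence
-- `x ∨ y`.
joined-par⁺ : ∀ {c : Chain m n} x y {A u v} → Joined c ((x ∨ y) ∷ A) u v → Joined (par c) (x ∷ y ∷ A) u v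
joined-par⁺ x y = EqC.map (step x y)
  where
  step : ∀ {c : Chain m n} x y {A u v} → Adjacent (chain c) ((x ∨ y) ∷ A) u v → Adjacent (chain (par c)) (x ∷ y ∷ A) u v
  step true  y     (zero  , here    , eq) = zero , here , eq
  step false true  (zero  , here    , eq) = suc zero , there here , eq
  step x     y     (suc e , there p , eq) = suc (suc e) , there (there p) , eq

joined-par⁻ : ∀ {c : Chain m n} x y {A u v} → Joined (par c) (x ∷ y ∷ A) u v → Joined c ((x ∨ y) ∷ A) u v
joined-par⁻ x y = EqC.map (step x y)
  where
  step : ∀ {c : Chain m n} x y {A u v} → Adjacent (chain (par c)) (x ∷ y ∷ A) u v → Adjacent (chain c) ((x ∨ y) ∷ A) u v
  step true  y     (zero        , here            , eq) = zero , here , eq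
  step true  true  (suc zero    , there here      , eq) = zero , here , eq
  step false true  (suc zero    , there here      , eq) = zero , here , eq
  step x     y     (suc (suc e) , there (there p) , eq) = suc e , there p , eq

joined-ser⁺ : ∀ {c : Chain m n} {x A u v} → Joined c A u v → Joined (ser c) (x ∷ A) (suc u) (suc v)
joined-ser⁺ = EqC.gmap suc λ { (e , p , refl) → suc e , there p , refl }

joined-first : ∀ {c : Chain m n} {A} → Joined c (inside ∷ A) zero (suc zero)
joined-first = EqC.return (zero , here , refl)

-- Contraction of the newest edge of `ser c`; it sends paths to paths whether or not that edge is
-- present.
collapse : Fin (suc (suc n)) → Fin (suc n)
collapse zero    = zero
collapse (suc v) = v

joined-ser⁻ : ∀ {c : Chain m n} {x A u v} → Joined (ser c) (x ∷ A) u v → Joined c A (collapse u) (collapse v)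
joined-ser⁻ = EqC.gfold (EqC.isEquivalence _) collapse
  λ { (zero , here , refl) → ε ; (suc e , there p , refl) → EqC.return (e , p , refl) }

-- With the newest edge absent, no remaining edge touches the first vertex, so `isZero` is constant
-- along paths.
unjoined-ser : ∀ {c : Chain m n} {A v} → ¬ Joined (ser c) (outside ∷ A) zero (suc v)
unjoined-ser {A = A} p = contradiction (EqC.gfold isEquivalence isZero (λ { (suc e , there _ , refl) → refl }) p) λ ()
  where
  isZero : Fin (suc n) → Bool
  isZero zero    = true
  isZero (suc _) = false

count-cong : ∀ {a b p q} {A : Set a} {B : Set b} {P : Pred A p} {Q : Pred B q}
             (P? : Decidable P) (Q? : Decidable Q) {n} (f : Fin n → A) (g : Fin n → B) →
             (∀ i → P (f i) ⇔ Q (g i)) →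
             length (filter P? (tabulate f)) ≡ length (filter Q? (tabulate g))
count-cong P? Q? {zero}  f g P⇔Q = refl
count-cong P? Q? {suc n} f g P⇔Q with P? (f zero) | Q? (g zero)
... | yes p | yes q = cong suc (count-cong P? Q? (f ∘ suc) (g ∘ suc) (P⇔Q ∘ suc))
... | yes p | no ¬q = contradiction (Equivalence.to (P⇔Q zero) p) ¬q
... | no ¬p | yes q = contradiction (Equivalence.from (P⇔Q zero) q) ¬p
... | no ¬p | no ¬q = count-cong P? Q? (f ∘ suc) (g ∘ suc) (P⇔Q ∘ suc)

Least : Chain m n → Subset (suc m) → Fin (suc (suc n)) → Set
Least c A v = ∀ u → Joined c A u v → v Fin.≤ u

least? : ∀ (c : Chain m n) A → Decidable (Least c A)
least? c A v = Fin.all? (λ u → connected? (chain c) A u v →-dec (v Fin.≤? u))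

zero-least : ∀ (c : Chain m n) A → Least c A zero
zero-least c A u _ = z≤n

κ-par : ∀ (c : Chain m n) x y A → κ (chain (par c)) (x ∷ y ∷ A) ≡ κ (chain c) ((x ∨ y) ∷ A)
κ-par c x y A = count-cong (least? (par c) _) (least? c _) id id λ v → mk⇔
  (λ least u p → least u (joined-par⁺ x y p))
  (λ least u p → least u (joined-par⁻ x y p))

κ-ser-outside : ∀ (c : Chain m n) A → κ (chain (ser c)) (outside ∷ A) ≡ suc (κ (chain c) A)
κ-ser-outside c A = trans
  (cong length (filter-accept (least? (ser c) (outside ∷ A)) {xs = tabulate suc} (zero-least (ser c) (outside ∷ A))))
  (cong suc (count-cong (least? (ser c) (outside ∷ A)) (least? c A) suc id λ v → mk⇔
    (λ least u p → ℕ.≤-pred (least (suc u) (joined-ser⁺ p)))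
    (λ { least zero p → contradiction p unjoined-ser ; least (suc u) p → s≤s (least u (joined-ser⁻ p)) })))

-- The new first vertex replaces the old one as least vertex of their common component; the other
-- minima are only shifted.
κ-ser-inside : ∀ (c : Chain m n) A → κ (chain (ser c)) (inside ∷ A) ≡ κ (chain c) A
κ-ser-inside c A = begin
  κ (chain (ser c)) (inside ∷ A)
    ≡⟨ cong length (filter-accept (least? (ser c) (inside ∷ A)) {xs = tabulate suc} (zero-least (ser c) (inside ∷ A))) ⟩
  suc (length (filter (least? (ser c) (inside ∷ A)) (tabulate suc)))
    ≡⟨ cong (suc ∘ length) (filter-reject (least? (ser c) (inside ∷ A)) {xs = tabulate (2 Fin.↑ʳ_)}
         λ least → contradiction (least zero joined-first) λ ()) ⟩
  suc (length (filter (least? (ser c) (inside ∷ A)) (tabulate (2 Fin.↑ʳ_))))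
    ≡⟨ cong suc (count-cong (least? (ser c) (inside ∷ A)) (least? c A) (2 Fin.↑ʳ_) suc λ v → mk⇔
         (λ least u p → ℕ.≤-pred (least (suc u) (joined-ser⁺ p)))
         (λ { least zero p → contradiction (least zero (joined-ser⁻ p)) λ ()
            ; least (suc u) p → s≤s (least u (joined-ser⁻ p)) })) ⟩
  suc (length (filter (least? c A) (tabulate suc)))
    ≡⟨ cong length (filter-accept (least? c A) {xs = tabulate suc} (zero-least c A)) ⟨
  κ (chain c) A ∎
  where open ≡-Reasoning

-- The number of bundles that contain no edge of A.
gaps : Chain m n → Subset (suc m) → ℕ
gaps edge    (true  ∷ []) = 0
gaps edge    (false ∷ []) = 1
gaps (par c) (x ∷ y ∷ A)  = gaps c ((x ∨ y) ∷ A)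
gaps (ser c) (true  ∷ A)  = gaps c A
gaps (ser c) (false ∷ A)  = suc (gaps c A)

κ≡1+gaps : ∀ (c : Chain m n) A → κ (chain c) A ≡ suc (gaps c A)
κ≡1+gaps edge    (true  ∷ []) = refl
κ≡1+gaps edge    (false ∷ []) = refl
κ≡1+gaps (par c) (x ∷ y ∷ A)  = trans (κ-par c x y A) (κ≡1+gaps c ((x ∨ y) ∷ A))
κ≡1+gaps (ser c) (true  ∷ A)  = trans (κ-ser-inside c A) (κ≡1+gaps c A)
κ≡1+gaps (ser c) (false ∷ A)  = trans (κ-ser-outside c A) (cong suc (κ≡1+gaps c A))

EndsJoined : Chain m n → Subset (suc m) → Set
EndsJoined {n = n} c A = Joined c A zero (fromℕ (suc n))

gapless⇒joined : ∀ (c : Chain m n) A → gaps c A ≡ 0 → EndsJoined c A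
gapless⇒joined edge    (true ∷ []) _  = joined-first
gapless⇒joined (par c) (x ∷ y ∷ A) eq = joined-par⁺ x y (gapless⇒joined c ((x ∨ y) ∷ A) eq)
gapless⇒joined (ser c) (true ∷ A)  eq = joined-first ◅◅ joined-ser⁺ (gapless⇒joined c A eq)

joined⇒gapless : ∀ (c : Chain m n) A → EndsJoined c A → gaps c A ≡ 0
joined⇒gapless edge    (true  ∷ []) _ = refl
joined⇒gapless edge    (false ∷ []) p = contradiction p (from-no (connected? (chain edge) (false ∷ []) zero (suc zero)))
joined⇒gapless (par c) (x ∷ y ∷ A)  p = joined⇒gapless c ((x ∨ y) ∷ A) (joined-par⁻ x y p)
joined⇒gapless (ser c) (true  ∷ A)  p = joined⇒gapless c A (joined-ser⁻ p)
joined⇒gapless (ser c) (false ∷ A)  p = contradiction p unjoined-ser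

gaps-⊤ : ∀ (c : Chain m n) → gaps c ⊤ ≡ 0
gaps-⊤ edge    = refl
gaps-⊤ (par c) = gaps-⊤ c
gaps-⊤ (ser c) = gaps-⊤ c

plane : (c : Chain m n) → PlaneEmbedding (chain c)
plane {m} {n} c = record
  { rot        = rotation c
  ; rot-vertex = label⇔orbit (source c) (dartAt c) (source-rotate c) (orbit-dartAt c)
  ; #F         = suc (#par c)
  ; face       = faceOf c
  ; face-onto  = λ f → dartOn c f , λ { refl → faceOf-dartOn c f }
  ; face-walk  = label⇔orbit (faceOf c) (dartOn c) (faceOf-walk c) (orbit-dartOn c)
  ; euler      = euler
  ; Outer      = _≡ faceOf c (zero , false)
  ; outer-uniq = λ d d′ out out′ _ → trans out (sym out′)
  }
  where
  open Graph (chain c) using (#V; #E; #isolated; Isolated; isolated?)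

  not-isolated : ∀ v → ¬ Isolated v
  not-isolated v iso with dartAt c v | source-dartAt c v
  ... | e , false | eq = proj₁ (iso e) eq
  ... | e , true  | eq = proj₂ (iso e) eq

  none-isolated : #isolated ≡ 0
  none-isolated = cong length (filter-none isolated? {xs = allFin (suc (suc n))} (All.tabulate λ {v} _ → not-isolated v))

  euler : suc (suc n) ℕ.+ (suc (#par c) ℕ.+ #isolated) ≡ suc m ℕ.+ 2 ℕ.* κ (chain c) ⊤
  euler rewrite none-isolated | κ≡1+gaps c ⊤ | gaps-⊤ c | ℕ.+-identityʳ (#par c) = cong suc (begin
    suc (n ℕ.+ suc (#par c)) ≡⟨ cong suc (ℕ.+-suc n (#par c)) ⟩
    2 ℕ.+ (n ℕ.+ #par c)     ≡⟨ cong (2 ℕ.+_) (#edges c) ⟨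
    2 ℕ.+ m                  ≡⟨ ℕ.+-comm 2 m ⟩
    m ℕ.+ 2                  ∎)
    where open ≡-Reasoning

gadget : Chain m n → TwoTerminalPlanarGraph
gadget {m} {n} c = record
  { graph     = chain c
  ; embedding = plane c
  ; s         = zero
  ; t         = fromℕ (suc n)
  ; s≢t       = λ ()
  ; s-outer   = inj₂ ((zero , false) , refl , refl)
  ; t-outer   = inj₂ (farDart c)
  }

-- The partition function of a chain

sumℚ-++ : ∀ xs ys → sumℚ (xs ++ ys) ≡ sumℚ xs + sumℚ ys
sumℚ-++ []       ys = sym (ℚ.+-identityˡ (sumℚ ys))
sumℚ-++ (x ∷ xs) ys = trans (cong (x +_) (sumℚ-++ xs ys)) (sym (ℚ.+-assoc x (sumℚ xs) (sumℚ ys)))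

sumℚ-*ˡ : ∀ a (f : X → ℚ) xs → sumℚ (map (λ x → a * f x) xs) ≡ a * sumℚ (map f xs)
sumℚ-*ˡ a f []       = sym (ℚ.*-zeroʳ a)
sumℚ-*ˡ a f (x ∷ xs) = trans (cong (a * f x +_) (sumℚ-*ˡ a f xs)) (sym (ℚ.*-distribˡ-+ a (f x) (sumℚ (map f xs))))

sumℚ-filter : ∀ {P : X → Set} (P? : Decidable P) (f g : X → ℚ) →
              (∀ x → P x → f x ≡ g x) → (∀ x → ¬ P x → g x ≡ 0ℚ) →
              ∀ xs → sumℚ (map f (filter P? xs)) ≡ sumℚ (map g xs)
sumℚ-filter P? f g f≡g g≡0 []       = refl
sumℚ-filter P? f g f≡g g≡0 (x ∷ xs) with P? x
... | yes Px = cong₂ _+_ (f≡g x Px) (sumℚ-filter P? f g f≡g g≡0 xs)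
... | no ¬Px = trans (sumℚ-filter P? f g f≡g g≡0 xs)
                     (sym (trans (cong (_+ sumℚ (map g xs)) (g≡0 x ¬Px)) (ℚ.+-identityˡ (sumℚ (map g xs)))))

sumℚ-partition : ∀ {P : X → Set} (P? : Decidable P) (f : X → ℚ) xs →
                 sumℚ (map f (filter P? xs)) + sumℚ (map f (filter (¬? ∘ P?) xs)) ≡ sumℚ (map f xs)
sumℚ-partition P? f []       = refl
sumℚ-partition P? f (x ∷ xs) with P? x
... | yes _ = trans (ℚ.+-assoc (f x) a b) (cong (f x +_) (sumℚ-partition P? f xs))
  where a = sumℚ (map f (filter P? xs)); b = sumℚ (map f (filter (¬? ∘ P?) xs))
... | no _  = trans (solve 3 (λ x a b → a :+ (x :+ b) := x :+ (a :+ b)) refl (f x) a b)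
                    (cong (f x +_) (sumℚ-partition P? f xs))
  where a = sumℚ (map f (filter P? xs)); b = sumℚ (map f (filter (¬? ∘ P?) xs))

sumSubsets : ∀ k → (Subset k → ℚ) → ℚ
sumSubsets k f = sumℚ (map f (allSubsets k))

sumSubsets-cong : ∀ k {f g : Subset k → ℚ} → (∀ A → f A ≡ g A) → sumSubsets k f ≡ sumSubsets k g
sumSubsets-cong k f≡g = cong sumℚ (map-cong f≡g (allSubsets k))

sumSubsets-suc : ∀ k f → sumSubsets (suc k) f ≡ sumSubsets k (f ∘ (outside ∷_)) + sumSubsets k (f ∘ (inside ∷_))
sumSubsets-suc k f = begin
  sumℚ (map f (map (outside ∷_) (allSubsets k) ++ map (inside ∷_) (allSubsets k)))
    ≡⟨ cong sumℚ (map-++ f (map (outside ∷_) (allSubsets k)) _) ⟩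
  sumℚ (map f (map (outside ∷_) (allSubsets k)) ++ map f (map (inside ∷_) (allSubsets k)))
    ≡⟨ sumℚ-++ (map f (map (outside ∷_) (allSubsets k))) _ ⟩
  sumℚ (map f (map (outside ∷_) (allSubsets k))) + sumℚ (map f (map (inside ∷_) (allSubsets k)))
    ≡⟨ cong₂ (λ xs ys → sumℚ xs + sumℚ ys) (map-∘ (allSubsets k)) (map-∘ (allSubsets k)) ⟨
  sumSubsets k (f ∘ (outside ∷_)) + sumSubsets k (f ∘ (inside ∷_)) ∎
  where open ≡-Reasoning

length-elements : ∀ {k} (A : Subset k) → length (filter (_∈? A) (allFin k)) ≡ ∣ A ∣
length-elements []            = refl
length-elements (true ∷ A)  = cong suc (trans
  (count-cong (_∈? (true ∷ A)) (_∈? A) suc id (λ _ → mk⇔ drop-there there)) (length-elements A))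
length-elements (false ∷ A) = trans
  (count-cong (_∈? (false ∷ A)) (_∈? A) suc id (λ _ → mk⇔ drop-there there)) (length-elements A)

productℚ-const : ∀ a (xs : List X) → productℚ (map (λ _ → a) xs) ≡ a ^ length xs
productℚ-const a []       = refl
productℚ-const a (x ∷ xs) = cong (a *_) (productℚ-const a xs)

module _ (α χ : ℚ) where

  -- For χ = q and χ = 0 these sums are, up to a factor q, the partition function
  -- and its part Z_st.
  gapSum : Chain m n → ℚ
  gapSum {m} c = sumSubsets (suc m) λ A → α ^ ∣ A ∣ * χ ^ gaps c A

  insert : Subset (suc m) → Subset (suc m)
  insert (_ ∷ A) = inside ∷ A

  -- As gapSum, but with the ends of the first bundle identified.
  contractedSum : Chain m n → ℚ
  contractedSum {m} c = sumSubsets (suc m) λ A → α ^ ∣ A ∣ * χ ^ gaps c (insert A)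

  scaled : ∀ k (w : Subset k → ℚ) → sumSubsets k (λ A → α * α ^ ∣ A ∣ * w A) ≡ α * sumSubsets k (λ A → α ^ ∣ A ∣ * w A)
  scaled k w = trans (sumSubsets-cong k (λ A → ℚ.*-assoc α (α ^ ∣ A ∣) (w A))) (sumℚ-*ˡ α (λ A → α ^ ∣ A ∣ * w A) (allSubsets k))

  -- Deletion and contraction at the new edge: once it is present, the first bundle has no gap
  -- whatever the old edges do.
  gapSum-par : (c : Chain m n) → gapSum (par c) ≡ gapSum c + α * contractedSum c
  gapSum-par {m} c = trans (sumSubsets-suc (suc m) _) (cong₂ _+_
    (sumSubsets-cong (suc m) λ { (_ ∷ _) → refl })
    (trans (sumSubsets-cong (suc m) λ { (_ ∷ _) → refl }) (scaled (suc m) λ A → χ ^ gaps c (insert A))))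

  -- With the ends of the bundle identified, the new edge is a loop and contributes the factor
  -- `1ℚ + α`.
  contractedSum-par : (c : Chain m n) → contractedSum (par c) ≡ (1ℚ + α) * contractedSum c
  contractedSum-par {m} c = trans (trans (sumSubsets-suc (suc m) _) (cong₂ _+_
    (sumSubsets-cong (suc m) λ { (_ ∷ _) → refl })
    (trans (sumSubsets-cong (suc m) λ { (_ ∷ _) → refl }) (scaled (suc m) λ A → χ ^ gaps c (insert A)))))
    (solve 2 (λ a s → s :+ a :* s := (con 1ℚ :+ a) :* s) refl α (contractedSum c))

  gapSum-ser : (c : Chain m n) → gapSum (ser c) ≡ (χ + α) * gapSum c
  gapSum-ser {m} c = trans (trans (sumSubsets-suc (suc m) _) (cong₂ _+_
    (trans (sumSubsets-cong (suc m) λ A → solve 3 (λ x y z → x :* (y :* z) := y :* (x :* z)) refl (α ^ ∣ A ∣) χ (χ ^ gaps c A))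
           (sumℚ-*ˡ χ (λ A → α ^ ∣ A ∣ * χ ^ gaps c A) (allSubsets (suc m))))
    (scaled (suc m) λ A → χ ^ gaps c A)))
    (sym (ℚ.*-distribʳ-+ (gapSum c) χ α))

  contractedSum-ser : (c : Chain m n) → contractedSum (ser c) ≡ (1ℚ + α) * gapSum c
  contractedSum-ser {m} c = trans (trans (sumSubsets-suc (suc m) _) (cong (gapSum c +_) (scaled (suc m) λ A → χ ^ gaps c A)))
    (solve 2 (λ a s → s :+ a :* s := (con 1ℚ :+ a) :* s) refl α (gapSum c))

  gapSum-edge : gapSum edge ≡ χ + α
  gapSum-edge = solve 2 (λ a x → con 1ℚ :* (x :* con 1ℚ) :+ (a :* con 1ℚ :* con 1ℚ :+ con 0ℚ) := x :+ a) refl α χ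

  contractedSum-edge : contractedSum edge ≡ 1ℚ + α
  contractedSum-edge = solve 1 (λ a → con 1ℚ :* con 1ℚ :+ (a :* con 1ℚ :* con 1ℚ :+ con 0ℚ) := con 1ℚ :+ a) refl α

thicken : ∀ k → Chain m n → Chain (k ℕ.+ m) n
thicken zero    c = c
thicken (suc k) c = par (thicken k c)

-- The weight of k + 1 parallel edges of weight α.
bundleWeight : ℚ → ℕ → ℚ
bundleWeight α k = (1ℚ + α) ^ suc k - 1ℚ

module _ (α χ : ℚ) where

  private y = 1ℚ + α

  contractedSum-thicken : ∀ k (c : Chain m n) → contractedSum α χ (thicken k c) ≡ y ^ k * contractedSum α χ c
  contractedSum-thicken zero    c = sym (ℚ.*-identityˡ (contractedSum α χ c))
  contractedSum-thicken (suc k) c = trans (contractedSum-par α χ (thicken k c))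
    (trans (cong (y *_) (contractedSum-thicken k c)) (sym (ℚ.*-assoc y (y ^ k) (contractedSum α χ c))))

  -- The `k` new edges contribute the geometric sum `α (1 + y + … + yᵏ⁻¹) = yᵏ - 1`.
  gapSum-thicken : ∀ k (c : Chain m n) → gapSum α χ (thicken k c) ≡ gapSum α χ c + (y ^ k - 1ℚ) * contractedSum α χ c
  gapSum-thicken zero    c = solve 2 (λ g f → g := g :+ (con 1ℚ :- con 1ℚ) :* f) refl (gapSum α χ c) (contractedSum α χ c)
  gapSum-thicken (suc k) c = trans (gapSum-par α χ (thicken k c))
    (trans (cong₂ (λ g f → g + α * f) (gapSum-thicken k c) (contractedSum-thicken k c))
      (solve 4 (λ a p g f → (g :+ (p :- con 1ℚ) :* f) :+ a :* (p :* f) := g :+ ((con 1ℚ :+ a) :* p :- con 1ℚ) :* f) refl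
        α (y ^ k) (gapSum α χ c) (contractedSum α χ c)))

  gapSum-bundle : ∀ k → gapSum α χ (thicken k edge) ≡ χ + bundleWeight α k
  gapSum-bundle k = trans (gapSum-thicken k edge)
    (trans (cong₂ (λ g f → g + (y ^ k - 1ℚ) * f) (gapSum-edge α χ) (contractedSum-edge α χ))
      (solve 3 (λ a x p → (x :+ a) :+ (p :- con 1ℚ) :* (con 1ℚ :+ a) := x :+ ((con 1ℚ :+ a) :* p :- con 1ℚ)) refl
        α χ (y ^ k)))

  gapSum-bundle-ser : ∀ k (c : Chain m n) → gapSum α χ (thicken k (ser c)) ≡ (χ + bundleWeight α k) * gapSum α χ c
  gapSum-bundle-ser k c = trans (gapSum-thicken k (ser c))
    (trans (cong₂ (λ g f → g + (y ^ k - 1ℚ) * f) (gapSum-ser α χ c) (contractedSum-ser α χ c))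
      (solve 4 (λ a x p s → (x :+ a) :* s :+ (p :- con 1ℚ) :* ((con 1ℚ :+ a) :* s) := (x :+ ((con 1ℚ :+ a) :* p :- con 1ℚ)) :* s) refl
        α χ (y ^ k) (gapSum α χ c)))

module _ (q α : ℚ) where

  term-chain : (c : Chain m n) → ∀ A → term q (gadget c) (λ _ → α) A ≡ q * (α ^ ∣ A ∣ * q ^ gaps c A)
  term-chain {m} c A = trans
    (cong₂ _*_ (trans (productℚ-const α (filter (_∈? A) (allFin (suc m)))) (cong (α ^_) (length-elements A)))
               (cong (q ^_) (κ≡1+gaps c A)))
    (solve 3 (λ x y z → x :* (y :* z) := y :* (x :* z)) refl (α ^ ∣ A ∣) q (q ^ gaps c A))

  -- `0ℚ ^ gaps c A` is the indicator of `EndsJoined c A`, because `0ℚ ^ 0` is `1ℚ`.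
  Z-st-chain : (c : Chain m n) → Z-st q (gadget c) (λ _ → α) ≡ q * gapSum α 0ℚ c
  Z-st-chain {m} {n} c = trans
    (sumℚ-filter (λ A → Graph.connected? (chain c) A zero (fromℕ (suc n)))
      (term q (gadget c) (λ _ → α)) (λ A → q * (α ^ ∣ A ∣ * 0ℚ ^ gaps c A)) joined unjoined (allSubsets (suc m)))
    (sumℚ-*ˡ q _ (allSubsets (suc m)))
    where
    joined : ∀ A → EndsJoined c A → term q (gadget c) (λ _ → α) A ≡ q * (α ^ ∣ A ∣ * 0ℚ ^ gaps c A)
    joined A p = trans (term-chain c A) (cong (λ x → q * (α ^ ∣ A ∣ * x))
      (trans (cong (q ^_) gapless) (sym (cong (0ℚ ^_) gapless))))
      where gapless = joined⇒gapless c A p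

    unjoined : ∀ A → ¬ EndsJoined c A → q * (α ^ ∣ A ∣ * 0ℚ ^ gaps c A) ≡ 0ℚ
    unjoined A ¬p with gaps c A in eq
    ... | zero  = contradiction (gapless⇒joined c A eq) ¬p
    ... | suc g = trans (cong (λ x → q * (α ^ ∣ A ∣ * x)) (ℚ.*-zeroˡ (0ℚ ^ g)))
                        (solve 2 (λ q x → q :* (x :* con 0ℚ) := con 0ℚ) refl q (α ^ ∣ A ∣))

  Z-chain : (c : Chain m n) → Z-st q (gadget c) (λ _ → α) + Z-s|t q (gadget c) (λ _ → α) ≡ q * gapSum α q c
  Z-chain {m} {n} c = trans
    (sumℚ-partition (λ A → Graph.connected? (chain c) A zero (fromℕ (suc n))) (term q (gadget c) (λ _ → α)) (allSubsets (suc m)))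
    (trans (sumSubsets-cong (suc m) (term-chain c)) (sumℚ-*ˡ q _ (allSubsets (suc m))))

-- Greedy approximation

-- Bundle k has weight v k. A bundle list ks with N = ∏ v k and D = ∏ (q + v k)
-- implements q N / (D - N), which exceeds T exactly when T D < (T + q) N.
module Approximation (q T : ℚ) (q>0 : 0ℚ < q) (T>0 : 0ℚ < T) (v : ℕ → ℚ) (v>0 : ∀ k → 0ℚ < v k) where

  prod : ℚ → List ℕ → ℚ
  prod χ ks = productℚ (map (λ k → χ + v k) ks)

  N D : List ℕ → ℚ
  N = prod 0ℚ
  D = prod q

  prod>0 : ∀ {χ} → 0ℚ ≤ χ → ∀ ks → 0ℚ < prod χ ks
  prod>0 χ≥0 []       = ℚ.positive⁻¹ 1ℚ
  prod>0 χ≥0 (k ∷ ks) = ℚ.+-mono-≤-< χ≥0 (v>0 k) ⊛⁺ prod>0 χ≥0 ks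

  Above : List ℕ → Set
  Above ks = T * D ks < (T + q) * N ks

  -- The factor still missing from `D / N` to reach `1 + q / T` is `(T + q) N / (T D)`. It is
  -- required to be at most `1 + c q / v k`, so by Bernoulli's inequality `c` further factors
  -- `1 + q / v k` suffice: `c` is a budget of copies of index `k`.
  Within : ℕ → ℕ → List ℕ → Set
  Within k c ks = (T + q) * N ks * v k ≤ T * D ks * (v k + ⟦ c ⟧ * q)

  private
    T≥0 = ℚ.<⇒≤ T>0
    q≥0 = ℚ.<⇒≤ q>0
    N≥0 = λ ks → ℚ.<⇒≤ (prod>0 ℚ.≤-refl ks)
    D≥0 = λ ks → ℚ.<⇒≤ (prod>0 q≥0 ks)

  -- With `x = q / v k` the reason is `1 + (c + 1) x ≤ (1 + c x) (1 + x)`; the slack `c x²` becomes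
  -- the summand `T * D * c * q * q`.
  append : ∀ {k c ks} → Within k (suc c) ks → Within k c (k ∷ ks)
  append {k} {c} {ks} within = ≤-by
    (ℚ.<⇒≤ (v>0 k) ⊛ gap≥0 within ⊕ T≥0 ⊛ D≥0 ks ⊛ ⟦⟧≥0 c ⊛ q≥0 ⊛ q≥0)
    (solve 6 (λ T q v c N D →
      T :* ((q :+ v) :* D) :* (v :+ c :* q) :=
      (T :+ q) :* ((con 0ℚ :+ v) :* N) :* v :+
      (v :* (T :* D :* (v :+ (con 1ℚ :+ c) :* q) :- (T :+ q) :* N :* v) :+ T :* D :* c :* q :* q))
      refl T q (v k) ⟦ c ⟧ (N ks) (D ks))

  -- Since `v (suc k) ≤ C v k`, one factor of index `k` is worth at most `C` in the budget of the
  -- next index: `q / v k ≤ C q / v (suc k)`.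
  advance : ∀ {C k ks} → v (suc k) ≤ ⟦ C ⟧ * v k → Within k 1 ks → Within (suc k) C ks
  advance {C} {k} {ks} growth within = cancel-≤ (v k) (v>0 k) (≤-by
    (ℚ.<⇒≤ (v>0 (suc k)) ⊛ gap≥0 within ⊕ T≥0 ⊛ D≥0 ks ⊛ q≥0 ⊛ gap≥0 growth)
    (solve 7 (λ T q v v′ C N D →
      v :* (T :* D :* (v′ :+ C :* q)) :=
      v :* ((T :+ q) :* N :* v′) :+
      (v′ :* (T :* D :* (v :+ (con 1ℚ :+ con 0ℚ) :* q) :- (T :+ q) :* N :* v) :+ T :* D :* q :* (C :* v :- v′)))
      refl T q (v k) (v (suc k)) ⟦ C ⟧ (N ks) (D ks)))

  exhausted : ∀ {k ks} → Within k 0 ks → (T + q) * N ks ≤ T * D ks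
  exhausted {k} {ks} within = cancel-≤ (v k) (v>0 k) (≤-by (gap≥0 within)
    (solve 5 (λ T q v N D → v :* (T :* D) :=
      v :* ((T :+ q) :* N) :+ (T :* D :* (v :+ con 0ℚ :* q) :- (T :+ q) :* N :* v))
      refl T q (v k) (N ks) (D ks)))

  overshoot : ∀ {k ks} → ¬ Above (k ∷ ks) → Within k 1 ks
  overshoot {k} {ks} ¬above = ≤-by (gap≥0 (ℚ.≮⇒≥ ¬above))
    (solve 5 (λ T q v N D → T :* D :* (v :+ (con 1ℚ :+ con 0ℚ) :* q) :=
      (T :+ q) :* N :* v :+ (T :* ((q :+ v) :* D) :- (T :+ q) :* ((con 0ℚ :+ v) :* N)))
      refl T q (v k) (N ks) (D ks))

  -- Recursion on the number `f` of larger indices left, then on the budget `c`. Taking a copy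
  -- spends budget, and an empty budget contradicts `Above`. A copy that would overstep leaves
  -- budget 1, which `advance` converts into `C` at the next index; this gives the length bound.
  greedy : ∀ C → (∀ k → v (suc k) ≤ ⟦ C ⟧ * v k) →
           ∀ f k c ks → All (ℕ._≤ f ℕ.+ k) ks → Above ks → Within k c ks →
           ∃ λ ks′ → All (ℕ._≤ f ℕ.+ k) ks′ × length ks′ ℕ.≤ c ℕ.+ f ℕ.* C ℕ.+ length ks ×
                     Above ks′ × Within (f ℕ.+ k) 1 ks′
  greedy C growth f k c ks small above within with (T * D (k ∷ ks)) ℚ.<? ((T + q) * N (k ∷ ks))
  greedy C growth f k zero    ks small above within | yes _ =
    contradiction (ℚ.<-≤-trans above (exhausted {ks = ks} within)) (ℚ.<-irrefl refl)
  greedy C growth f k (suc c) ks small above within | yes above′ =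
    let ks′ , small′ , len , rest = greedy C growth f k c (k ∷ ks) (ℕ.m≤n+m k f ∷ small) above′ (append {c = c} {ks} within)
    in ks′ , small′ , ℕ.≤-trans len (ℕ.≤-reflexive (ℕ.+-suc (c ℕ.+ f ℕ.* C) (length ks))) , rest
  greedy C growth zero    k c ks small above within | no ¬above′ =
    ks , small , ℕ.m≤n+m (length ks) (c ℕ.+ 0) , above , overshoot {ks = ks} ¬above′
  greedy C growth (suc f) k c ks small above within | no ¬above′ =
    let ks′ , small′ , len , above′ , within′ = greedy C growth f (suc k) C ks
          (subst (λ b → All (ℕ._≤ b) ks) (sym (ℕ.+-suc f k)) small) above (advance {C = C} {k} {ks} (growth k) (overshoot {ks = ks} ¬above′))
    in ks′ , subst (λ b → All (ℕ._≤ b) ks′) (ℕ.+-suc f k) small′ ,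
       ℕ.≤-trans len (ℕ.+-monoˡ-≤ (length ks) (ℕ.m≤n+m (C ℕ.+ f ℕ.* C) c)) , above′ ,
       subst (λ b → Within b 1 ks′) (ℕ.+-suc f k) within′

  Below : List ℕ → Set
  Below ks = (T + q) * N ks ≤ T * D ks

  Precise : ℚ → List ℕ → Set
  Precise δ ks = (T - δ) * D ks ≤ (T - δ + q) * N ks

  last-below : ∀ {k ks} → Within k 1 ks → Below (k ∷ ks)
  last-below {k} {ks} within = ≤-by (gap≥0 within)
    (solve 5 (λ T q v N D → T :* ((q :+ v) :* D) :=
      (T :+ q) :* ((con 0ℚ :+ v) :* N) :+ (T :* D :* (v :+ (con 1ℚ :+ con 0ℚ) :* q) :- (T :+ q) :* N :* v))
      refl T q (v k) (N ks) (D ks))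

  -- Before the last factor the product is below `1 + q / T`, so the final weight satisfies
  -- `1 + q / w < (1 + q / T) (1 + q / v k)`. This rearranges to `w > T v k / (v k + T + q)`, which
  -- misses `T` by less than `T (T + q) / v k ≤ δ`.
  last-precise : ∀ {δ k ks} → 0ℚ ≤ δ → T * (T + q) ≤ δ * v k → Above ks → Within k 1 ks → Precise δ (k ∷ ks)
  last-precise {δ} {k} {ks} δ≥0 fine above within = cancel-≤ T T>0 (≤-by
    (T≥0 ⊛ (q≥0 ⊕ ℚ.<⇒≤ (v>0 k)) ⊛ gap≥0 (ℚ.<⇒≤ above) ⊕ δ≥0 ⊛ gap≥0 (last-below {ks = ks} within) ⊕ q≥0 ⊛ N≥0 ks ⊛ gap≥0 fine)
    (solve 6 (λ T q v e N D →
      T :* ((T :- e :+ q) :* ((con 0ℚ :+ v) :* N)) :=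
      T :* ((T :- e) :* ((q :+ v) :* D)) :+
      (T :* (q :+ v) :* ((T :+ q) :* N :- T :* D) :+
       e :* (T :* ((q :+ v) :* D) :- (T :+ q) :* ((con 0ℚ :+ v) :* N)) :+
       q :* N :* (e :* v :- T :* (T :+ q))))
      refl T q (v k) δ (N ks) (D ks)))

-- Chains realising a given list of bundles

chainOf : ℕ → List ℕ → ∃₂ Chain
-- A chain has at least one bundle; `k` belongs to the innermost, and `k` counts the edges beyond
-- the first.
chainOf k []       = _ , _ , thicken k edge
chainOf k (j ∷ js) = let _ , _ , c = chainOf k js in _ , _ , thicken j (ser c)

gapSum-chainOf : ∀ α χ k js → gapSum α χ (proj₂ (proj₂ (chainOf k js))) ≡
                 productℚ (map (λ j → χ + bundleWeight α j) (k ∷ js))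
gapSum-chainOf α χ k []       = trans (gapSum-bundle α χ k) (sym (ℚ.*-identityʳ (χ + bundleWeight α k)))
gapSum-chainOf α χ k (j ∷ js) =
  trans (gapSum-bundle-ser α χ j (proj₂ (proj₂ (chainOf k js))))
 (trans (cong ((χ + bundleWeight α j) *_) (gapSum-chainOf α χ k js))
        (solve 3 (λ x y p → x :* (y :* p) := y :* (x :* p)) refl
          (χ + bundleWeight α j) (χ + bundleWeight α k) (productℚ (map (λ j → χ + bundleWeight α j) js))))

edges-chainOf : ∀ {B k js} → k ℕ.< B → All (ℕ._< B) js → suc (proj₁ (chainOf k js)) ℕ.≤ B ℕ.* suc (length js)
edges-chainOf {B} {k} k<B [] = ℕ.≤-trans (ℕ.≤-reflexive (cong suc (ℕ.+-identityʳ k)))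
                              (ℕ.≤-trans k<B (ℕ.≤-reflexive (sym (ℕ.*-identityʳ B))))
edges-chainOf {B} {k} {j ∷ js} k<B (j<B ∷ js<B) =
  ℕ.≤-trans (ℕ.+-mono-≤ j<B (edges-chainOf k<B js<B)) (ℕ.≤-reflexive (sym (ℕ.*-suc B (suc (length js)))))

size-chain : (c : Chain m n) → Graph.size (chain c) ℕ.≤ suc (2 ℕ.* suc m)
size-chain {m} {n} c = begin
  suc (suc n) ℕ.+ suc m       ≤⟨ ℕ.+-monoˡ-≤ (suc m) (s≤s (s≤s n≤m)) ⟩
  suc (suc m ℕ.+ suc m)       ≡⟨ cong (λ k → suc (suc m ℕ.+ k)) (ℕ.+-identityʳ (suc m)) ⟨
  suc (2 ℕ.* suc m)           ∎
  where
  open ℕ.≤-Reasoning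
  n≤m : n ℕ.≤ m
  n≤m = ℕ.≤-trans (ℕ.m≤m+n n (#par c)) (ℕ.≤-reflexive (sym (#edges c)))

Approximates : (q α T δ : ℚ) → Chain m n → Set
Approximates q α T δ c = ∃ λ w → Implements q (gadget c) (λ _ → α) w × T - δ ≤ w × w ≤ T

-- Both bounds on `w` are multiplied by `Zs|t = q (D - N)`. This is positive because the upper
-- estimate itself forces `T N < (T + q) N ≤ T D`.
implements-between : ∀ {q α T δ} (c : Chain m n) → 0ℚ < q → 0ℚ < T → 0ℚ < gapSum α 0ℚ c →
  (T + q) * gapSum α 0ℚ c ≤ T * gapSum α q c →
  (T - δ) * gapSum α q c ≤ (T - δ + q) * gapSum α 0ℚ c →
  Approximates q α T δ c
implements-between {q = q} {α} {T} {δ} c q>0 T>0 N>0 below precise =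
  w , (Z≢0 , refl) , cancel-≤ Zs|t Z>0 lower , cancel-≤ Zs|t Z>0 upper
  where
  N = gapSum α 0ℚ c
  D = gapSum α q c
  Zst  = Z-st q (gadget c) (λ _ → α)
  Zs|t = Z-s|t q (gadget c) (λ _ → α)

  Zs|t≡ : Zs|t ≡ q * (D - N)
  Zs|t≡ = begin
    Zs|t                ≡⟨ solve 2 (λ a b → b := a :+ b :- a) refl Zst Zs|t ⟩
    Zst + Zs|t - Zst    ≡⟨ cong₂ _-_ (Z-chain q α c) (Z-st-chain q α c) ⟩
    q * D - q * N       ≡⟨ solve 3 (λ q d n → q :* d :- q :* n := q :* (d :- n)) refl q D N ⟩
    q * (D - N)         ∎
    where open ≡-Reasoning

  N<D : N < D
  N<D = cancel-< T T>0 (ℚ.<-≤-trans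
    (<-by (q>0 ⊛⁺ N>0) (solve 3 (λ t q n → (t :+ q) :* n := t :* n :+ q :* n) refl T q N)) below)

  Z>0 : 0ℚ < Zs|t
  Z>0 = subst (0ℚ <_) (sym Zs|t≡) (q>0 ⊛⁺ gap>0 N<D)

  Z≢0 : Zs|t ≢ 0ℚ
  Z≢0 Z≡0 = ℚ.<⇒≢ Z>0 (sym Z≡0)

  instance _ = ≢-nonZero Z≢0

  w : ℚ
  w = (q * Zst) ÷ Zs|t

  Z*w : Zs|t * w ≡ q * (q * N)
  Z*w = begin
    Zs|t * (q * Zst * ℚ.1/ Zs|t)   ≡⟨ solve 3 (λ z x i → z :* (x :* i) := x :* (z :* i)) refl Zs|t (q * Zst) (ℚ.1/ Zs|t) ⟩
    q * Zst * (Zs|t * ℚ.1/ Zs|t)   ≡⟨ cong (q * Zst *_) (ℚ.*-inverseʳ Zs|t) ⟩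
    q * Zst * 1ℚ                   ≡⟨ ℚ.*-identityʳ (q * Zst) ⟩
    q * Zst                        ≡⟨ cong (q *_) (Z-st-chain q α c) ⟩
    q * (q * N)                    ∎
    where open ≡-Reasoning

  upper : Zs|t * w ≤ Zs|t * T
  upper = subst₂ _≤_ (sym Z*w) (cong (_* T) (sym Zs|t≡)) (≤-by (ℚ.<⇒≤ q>0 ⊛ gap≥0 below)
    (solve 4 (λ q t n d → q :* (d :- n) :* t := q :* (q :* n) :+ q :* (t :* d :- (t :+ q) :* n)) refl q T N D))

  lower : Zs|t * (T - δ) ≤ Zs|t * w
  lower = subst₂ _≤_ (cong (_* (T - δ)) (sym Zs|t≡)) (sym Z*w) (≤-by (ℚ.<⇒≤ q>0 ⊛ gap≥0 precise)
    (solve 4 (λ q t n d → q :* (q :* n) := q :* (d :- n) :* t :+ q :* ((t :+ q) :* n :- t :* d)) refl q (T - δ) N D))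

-- Bundle k consists of 1 + multiplicity k = 2 (k + 1) edges.
multiplicity : ℕ → ℕ
multiplicity zero    = 1
multiplicity (suc k) = suc (suc (multiplicity k))

multiplicity-bound : ∀ {k K} → k ℕ.≤ K → multiplicity k ℕ.< 2 ℕ.* suc K
multiplicity-bound {zero}  {K}     _         = s≤s (ℕ.≤-trans (s≤s z≤n) (ℕ.m≤n+m (suc (K ℕ.+ 0)) K))
multiplicity-bound {suc k} {suc K} (s≤s k≤K) = ℕ.≤-trans (s≤s (s≤s (multiplicity-bound k≤K)))
  (ℕ.≤-reflexive (cong suc (sym (ℕ.+-suc (suc K) (suc K ℕ.+ 0)))))

-- Exponential growth of the bundle weights

module EvenBundles (α : ℚ) (β>0 : 0ℚ < (1ℚ + α) * (1ℚ + α) - 1ℚ) where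

  Y β : ℚ
  Y = (1ℚ + α) * (1ℚ + α)
  β = Y - 1ℚ

  v : ℕ → ℚ
  v k = bundleWeight α (multiplicity k)

  private
    β≥0 = ℚ.<⇒≤ β>0

  v-zero : v 0 ≡ β
  v-zero = solve 1 (λ a → (con 1ℚ :+ a) :* ((con 1ℚ :+ a) :* con 1ℚ) :- con 1ℚ := (con 1ℚ :+ a) :* (con 1ℚ :+ a) :- con 1ℚ) refl α

  v-suc : ∀ k → v (suc k) ≡ v k + (β * v k + β)
  v-suc k = solve 2 (λ y p → y :* (y :* p) :- con 1ℚ :=
      (p :- con 1ℚ) :+ ((y :* y :- con 1ℚ) :* (p :- con 1ℚ) :+ (y :* y :- con 1ℚ)))
    refl (1ℚ + α) ((1ℚ + α) ^ suc (multiplicity k))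

  β≤v : ∀ k → β ≤ v k
  β≤v zero    = ℚ.≤-reflexive (sym v-zero)
  β≤v (suc k) = ℚ.≤-trans (β≤v k) (≤-by (β≥0 ⊛ ℚ.≤-trans β≥0 (β≤v k) ⊕ β≥0) (v-suc k))

  v>0 : ∀ k → 0ℚ < v k
  v>0 k = ℚ.<-≤-trans β>0 (β≤v k)

  -- `v (suc k) = Y v k + β`, and `β ≤ v k`.
  v-growth : ∀ {C} → Y + 1ℚ ≤ ⟦ C ⟧ → ∀ k → v (suc k) ≤ ⟦ C ⟧ * v k
  v-growth {C} Y+1≤C k = ≤-by (gap≥0 Y+1≤C ⊛ ℚ.<⇒≤ (v>0 k) ⊕ gap≥0 (β≤v k))
    (trans (solve 3 (λ c y v → c :* v := v :+ ((y :- con 1ℚ) :* v :+ (y :- con 1ℚ)) :+ ((c :- (y :+ con 1ℚ)) :* v :+ (v :- (y :- con 1ℚ))))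
             refl ⟦ C ⟧ Y (v k))
           (cong (_+ ((⟦ C ⟧ - (Y + 1ℚ)) * v k + (v k - β))) (sym (v-suc k))))

  -- Each step adds at least `β v k`. This crude bound is enough: any `h ≥ 1 / β` steps double the
  -- weight, and iterated doubling gives exponential growth without logarithms.
  v-linear : ∀ j k → v k + ⟦ j ⟧ * (β * v k) ≤ v (j ℕ.+ k)
  v-linear zero    k = ℚ.≤-reflexive (solve 2 (λ v b → v :+ con 0ℚ :* (b :* v) := v) refl (v k) β)
  v-linear (suc j) k = ≤-by (gap≥0 (v-linear j k) ⊕ β≥0 ⊛ gap≥0 v≤v′ ⊕ β≥0)
    (trans (v-suc (j ℕ.+ k))
      (solve 4 (λ v w b j → w :+ (b :* w :+ b) :=
         v :+ (con 1ℚ :+ j) :* (b :* v) :+ (w :- (v :+ j :* (b :* v)) :+ b :* (w :- v) :+ b))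
        refl (v k) (v (j ℕ.+ k)) β ⟦ j ⟧))
    where
    v≤v′ : v k ≤ v (j ℕ.+ k)
    v≤v′ = ℚ.≤-trans (≤-by (⟦⟧≥0 j ⊛ (β≥0 ⊛ ℚ.<⇒≤ (v>0 k))) refl) (v-linear j k)

  v-double : ∀ {h} → 1ℚ ≤ ⟦ h ⟧ * β → ∀ k → v k + v k ≤ v (h ℕ.+ k)
  v-double {h} 1≤hβ k = ≤-by (gap≥0 (v-linear h k) ⊕ gap≥0 1≤hβ ⊛ ℚ.<⇒≤ (v>0 k))
    (solve 4 (λ v w b h → w := v :+ v :+ (w :- (v :+ h :* (b :* v)) :+ (h :* b :- con 1ℚ) :* v))
      refl (v k) (v (h ℕ.+ k)) β ⟦ h ⟧)

  v-exponential : ∀ {h k B} → 1ℚ ≤ ⟦ h ⟧ * β → B ≤ v k → ∀ m → B ≤ ½ ^ m * v (m ℕ.* h ℕ.+ k)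
  v-exponential {k = k} 1≤hβ B≤v zero = ℚ.≤-trans B≤v (ℚ.≤-reflexive (sym (ℚ.*-identityˡ (v k))))
  v-exponential {h} {k} {B} 1≤hβ B≤v (suc m) rewrite ℕ.+-assoc h (m ℕ.* h) k = ≤-by
    (gap≥0 (v-exponential {h} 1≤hβ B≤v m) ⊕ ℚ.<⇒≤ (½^>0 (suc m)) ⊛ gap≥0 (v-double {h} 1≤hβ (m ℕ.* h ℕ.+ k)))
    (solve 4 (λ B e v w → con ½ :* e :* w := B :+ (e :* v :- B :+ con ½ :* e :* (w :- (v :+ v))))
      refl B (½ ^ m) (v (m ℕ.* h ℕ.+ k)) (v (h ℕ.+ (m ℕ.* h ℕ.+ k))))

  v-unbounded : ∀ B → ∃ λ k → B ≤ v k
  v-unbounded B =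
    let j , B≤ = ⟦⟧-multiples-unbounded (β * v 0) (β>0 ⊛⁺ v>0 0) B
    in j ℕ.+ 0 , ℚ.≤-trans B≤ (ℚ.≤-trans (above j) (v-linear j 0))
    where
    above : ∀ j → ⟦ j ⟧ * (β * v 0) ≤ v 0 + ⟦ j ⟧ * (β * v 0)
    above j = ≤-by (ℚ.<⇒≤ (v>0 0)) (ℚ.+-comm (v 0) (⟦ j ⟧ * (β * v 0)))

-- Uniform approximation of rational targets

Approximable : (q α a b : ℚ) (C h k : ℕ) → Set
Approximable q α a b C h k = ∀ {T} → a ≤ T → T ≤ b → ∀ m →
  Σ (∃₂ Chain) λ (_ , _ , c) → Approximates q α T (½ ^ m) c ×
  (let S = suc (m ℕ.* h ℕ.+ k) in Graph.size (chain c) ℕ.≤ suc (4 ℕ.* S ℕ.* suc (C ℕ.* S)))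

module _ {q α a b : ℚ} (q>0 : 0ℚ < q) (β>0 : 0ℚ < (1ℚ + α) * (1ℚ + α) - 1ℚ) (a>0 : 0ℚ < a) where

  open EvenBundles α β>0

  -- `C` is both the initial budget at index 0 and the budget received at each later index.
  -- Precision 1 is available at index `k`, as `T (T + q) ≤ b (b + q) ≤ v k`, and every halving of
  -- the tolerance costs `h` more indices; hence `K = m h + k`.
  approximate-with : ∀ {C h k} → v 0 ≤ ⟦ C ⟧ * a → Y + 1ℚ ≤ ⟦ C ⟧ → 1ℚ ≤ ⟦ h ⟧ * β → b * (b + q) ≤ v k →
    Approximable q α a b C h k
  approximate-with {C} {h} {k} v₀≤Ca Y+1≤C 1≤hβ B≤v {T} a≤T T≤b m = (_ , _ , c) ,
    implements-between c q>0 T>0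
      (subst (0ℚ <_) (sym (gapSum≡ 0ℚ)) (prod>0 ℚ.≤-refl (K ∷ ks)))
      (subst₂ (λ x y → (T + q) * x ≤ T * y) (sym (gapSum≡ 0ℚ)) (sym (gapSum≡ q)) (last-below {K} {ks} within))
      (subst₂ (λ x y → (T - ½ ^ m) * x ≤ (T - ½ ^ m + q) * y) (sym (gapSum≡ q)) (sym (gapSum≡ 0ℚ))
        (last-precise {½ ^ m} {K} {ks} (ℚ.<⇒≤ (½^>0 m)) fine above within)) ,
    size-bound
    where
    T>0 = ℚ.<-≤-trans a>0 a≤T
    K = m ℕ.* h ℕ.+ k

    open Approximation q T q>0 T>0 v v>0

    above₀ : Above []
    above₀ = <-by q>0 (solve 2 (λ t q → (t :+ q) :* con 1ℚ := t :* con 1ℚ :+ q) refl T q)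

    -- Initially the missing factor is `1 + q / T`, and `v 0 ≤ C a ≤ C T`.
    within₀ : Within 0 C []
    within₀ = ≤-by (ℚ.<⇒≤ q>0 ⊛ (gap≥0 v₀≤Ca ⊕ ⟦⟧≥0 C ⊛ gap≥0 a≤T))
      (solve 5 (λ t q v c a → t :* con 1ℚ :* (v :+ c :* q) :=
          (t :+ q) :* con 1ℚ :* v :+ q :* (c :* a :- v :+ c :* (t :- a)))
        refl T q (v 0) ⟦ C ⟧ a)

    bundles : ∃ λ ks → All (ℕ._≤ K) ks × length ks ℕ.≤ C ℕ.+ K ℕ.* C ℕ.+ 0 × Above ks × Within K 1 ks
    bundles = subst (λ K′ → ∃ λ ks → All (ℕ._≤ K′) ks × length ks ℕ.≤ C ℕ.+ K ℕ.* C ℕ.+ 0 × Above ks × Within K′ 1 ks)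
      (ℕ.+-identityʳ K) (greedy C (v-growth {C} Y+1≤C) K 0 C [] [] above₀ within₀)

    ks     = proj₁ bundles
    small  = proj₁ (proj₂ bundles)
    short  = proj₁ (proj₂ (proj₂ bundles))
    above  = proj₁ (proj₂ (proj₂ (proj₂ bundles)))
    within = proj₂ (proj₂ (proj₂ (proj₂ bundles)))

    c = proj₂ (proj₂ (chainOf (multiplicity K) (map multiplicity ks)))

    gapSum≡ : ∀ χ → gapSum α χ c ≡ prod χ (K ∷ ks)
    gapSum≡ χ = trans (gapSum-chainOf α χ (multiplicity K) (map multiplicity ks))
                      (cong (λ xs → (χ + v K) * productℚ xs) (sym (map-∘ ks)))

    T[T+q]≤B : T * (T + q) ≤ b * (b + q)
    T[T+q]≤B = ≤-by (gap≥0 T≤b ⊛ (T≥0 ⊕ (T≥0 ⊕ gap≥0 T≤b) ⊕ ℚ.<⇒≤ q>0))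
      (solve 3 (λ t b q → b :* (b :+ q) := t :* (t :+ q) :+ (b :- t) :* (t :+ (t :+ (b :- t)) :+ q)) refl T b q)
      where T≥0 = ℚ.<⇒≤ T>0

    fine : T * (T + q) ≤ ½ ^ m * v K
    fine = ℚ.≤-trans T[T+q]≤B (v-exponential {h} {k} 1≤hβ B≤v m)

    size-bound : Graph.size (chain c) ℕ.≤ suc (4 ℕ.* suc K ℕ.* suc (C ℕ.* suc K))
    size-bound = begin
      Graph.size (chain c)
        ≤⟨ size-chain c ⟩
      suc (2 ℕ.* suc (proj₁ (chainOf (multiplicity K) (map multiplicity ks))))
        ≤⟨ s≤s (ℕ.*-monoʳ-≤ 2 (edges-chainOf (multiplicity-bound (ℕ.≤-refl {K}))
             (All.map⁺ (All.map multiplicity-bound small)))) ⟩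
      suc (2 ℕ.* (2 ℕ.* suc K ℕ.* suc (length (map multiplicity ks))))
        ≡⟨ cong (λ l → suc (2 ℕ.* (2 ℕ.* suc K ℕ.* suc l))) (length-map multiplicity ks) ⟩
      suc (2 ℕ.* (2 ℕ.* suc K ℕ.* suc (length ks)))
        ≤⟨ s≤s (ℕ.*-monoʳ-≤ 2 (ℕ.*-monoʳ-≤ (2 ℕ.* suc K) (s≤s short))) ⟩
      suc (2 ℕ.* (2 ℕ.* suc K ℕ.* suc (C ℕ.+ K ℕ.* C ℕ.+ 0)))
        ≡⟨ cong suc (regroup C K) ⟩
      suc (4 ℕ.* suc K ℕ.* suc (C ℕ.* suc K)) ∎
      where
      open ℕ.≤-Reasoning

      regroup : ∀ C K → 2 ℕ.* (2 ℕ.* suc K ℕ.* suc (C ℕ.+ K ℕ.* C ℕ.+ 0)) ≡ 4 ℕ.* suc K ℕ.* suc (C ℕ.* suc K)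
      regroup = solve-∀

  -- Without abstract, comparing the constants C, h, k later normalises them.
  abstract
    approximate : ∃ λ C → ∃₂ λ h k → Approximable q α a b C h k
    approximate =
      let C₀ , v₀≤C₀a   = ⟦⟧-multiples-unbounded a a>0 (v 0)
          -- Dominates both `C₀` and `Y + 1ℚ`, so a single constant meets both requirements.
          C , C₀+Y+1≤C = ⟦⟧-unbounded (⟦ C₀ ⟧ + (Y + 1ℚ))
          h , 1≤hβ     = ⟦⟧-multiples-unbounded β β>0 1ℚ
          k , B≤v      = v-unbounded (b * (b + q))
      in C , h , k , approximate-with {C} {h} {k}
           (ℚ.≤-trans v₀≤C₀a (ℚ.*-monoʳ-≤-nonNeg a {{ℚ.nonNegative (ℚ.<⇒≤ a>0)}} (ℚ.≤-trans (≤-by {⟦ C₀ ⟧} Y+1≥0 refl) C₀+Y+1≤C)))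
           (ℚ.≤-trans (≤-by (⟦⟧≥0 C₀) (ℚ.+-comm ⟦ C₀ ⟧ (Y + 1ℚ))) C₀+Y+1≤C)
           1≤hβ B≤v
      where
      Y+1≥0 : 0ℚ ≤ Y + 1ℚ
      Y+1≥0 = ℚ.≤-trans (ℚ.<⇒≤ β>0 ⊕ 0≤1 ⊕ 0≤1)
        (ℚ.≤-reflexive (solve 1 (λ y → y :- con 1ℚ :+ con 1ℚ :+ con 1ℚ := y :+ con 1ℚ) refl Y))

-- Real targets and the polynomial size bound

open import Data.Integer.Base using (+_)

-- The difference is `α (α + 2)`, whose factors have the same sign outside the interval.
square-expanding : ∀ {α} → ¬ (- (+ 2 / 1) ≤ α × α ≤ 0ℚ) → 0ℚ < (1ℚ + α) * (1ℚ + α) - 1ℚ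
square-expanding {α} α∉ with - (+ 2 / 1) ℚ.≤? α | α ℚ.≤? 0ℚ
... | yes -2≤α | yes α≤0 = contradiction (-2≤α , α≤0) α∉
... | _        | no α≰0  = subst (0ℚ <_)
  (solve 1 (λ a → a :* (a :+ con (+ 2 / 1)) := (con 1ℚ :+ a) :* (con 1ℚ :+ a) :- con 1ℚ) refl α)
  (α>0 ⊛⁺ (α>0 ⊕⁺ ℚ.positive⁻¹ (+ 2 / 1)))
  where α>0 = ℚ.≰⇒> α≰0
... | no -2≰α  | yes _   = subst (0ℚ <_)
  (solve 1 (λ a → (con (- (+ 2 / 1)) :- a) :* (con (+ 2 / 1) :+ (con (- (+ 2 / 1)) :- a)) := (con 1ℚ :+ a) :* (con 1ℚ :+ a) :- con 1ℚ) refl α)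
  (gap ⊛⁺ (ℚ.positive⁻¹ (+ 2 / 1) ⊕⁺ gap))
  where gap = gap>0 (ℚ.≰⇒> -2≰α)

-- The coefficients of 1 + 4 S (1 + C S) for S = h x + g, g = 1 + 3 h + k.
sizePoly : ℕ → ℕ → ℕ → List ℕ
sizePoly C h k = let g = suc (3 ℕ.* h ℕ.+ k) in
  suc (4 ℕ.* g ℕ.* suc (C ℕ.* g)) ∷ 4 ℕ.* h ℕ.+ 8 ℕ.* C ℕ.* h ℕ.* g ∷ 4 ℕ.* C ℕ.* h ℕ.* h ∷ []

-- The 3 collects the 2 lost in `dyadic-below` and the 1 for halving the tolerance in `realise`.
sizePoly-bound : ∀ C h k {m n} → m ℕ.≤ 3 ℕ.+ n →
  (let S = suc (m ℕ.* h ℕ.+ k) in suc (4 ℕ.* S ℕ.* suc (C ℕ.* S))) ℕ.≤ evalPoly (sizePoly C h k) n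
sizePoly-bound C h k {m} {n} m≤3+n = begin
  suc (4 ℕ.* S ℕ.* suc (C ℕ.* S))
    ≤⟨ s≤s (ℕ.*-mono-≤ (ℕ.*-monoʳ-≤ 4 S≤S′) (s≤s (ℕ.*-monoʳ-≤ C S≤S′))) ⟩
  suc (4 ℕ.* S′ ℕ.* suc (C ℕ.* S′))
    ≡⟨ expand C h k n ⟩
  evalPoly (sizePoly C h k) n ∎
  where
  open ℕ.≤-Reasoning
  S  = suc (m ℕ.* h ℕ.+ k)
  S′ = suc ((3 ℕ.+ n) ℕ.* h ℕ.+ k)

  expand : ∀ C h k n → (let S = suc ((3 ℕ.+ n) ℕ.* h ℕ.+ k); g = suc (3 ℕ.* h ℕ.+ k) in
    suc (4 ℕ.* S ℕ.* suc (C ℕ.* S)) ≡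
    suc (4 ℕ.* g ℕ.* suc (C ℕ.* g)) ℕ.+ n ℕ.* (4 ℕ.* h ℕ.+ 8 ℕ.* C ℕ.* h ℕ.* g ℕ.+ n ℕ.* (4 ℕ.* C ℕ.* h ℕ.* h ℕ.+ n ℕ.* 0)))
  expand = solve-∀

  S≤S′ : S ℕ.≤ S′
  S≤S′ = s≤s (ℕ.+-monoˡ-≤ k (ℕ.*-monoˡ-≤ h m≤3+n))

-- The tolerance `½ ^ m` is split in two: `T` is within `½ ^ suc m` of the cut `T*`, and `w` within
-- `½ ^ suc m` of `T`. Both errors point downwards, so `w` stays below `T*`.
realise : ∀ {q α a b C h k} →
  Approximable q α a b C h k →
  ∀ T* → ℝ.L T* a → ℝ.U T* b → ∀ π → fromℚ 0ℚ <ᴿ π →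
  Σ (∃₂ Chain) λ (_ , _ , c) →
  (∃ λ w* → Implements q (gadget c) (λ _ → α) w* × T* ≤ᴿ w* ⊹ π × fromℚ w* ≤ᴿ T*) ×
  Graph.size (chain c) ≤poly sizePoly C h k [log π ⁻¹]
realise {C = C} {h} {k} approx T* La Ub π π>0 =
  let m , Lm , least                 = dyadic-below π π>0
      T , a≤T , LT , UT              = rational-below T* (½^>0 (suc m)) La
      c , (w , imp , T-δ≤w , w≤T) , size = approx a≤T (ℚ.<⇒≤ (L<U T* LT Ub)) (suc m)
  in c , (w , imp
         , (λ r Lr → L-down π (close m {T} T-δ≤w (L<U T* Lr UT)) Lm)
         , (λ r r<w → L-down T* (ℚ.≤-trans (ℚ.<⇒≤ r<w) w≤T) LT))
       , λ n ½^n≤π → ℕ.≤-trans size (sizePoly-bound C h k (s≤s (least n ½^n≤π)))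
  where
  close : ∀ m {T w r} → T - ½ ^ suc m ≤ w → r < T + ½ ^ suc m → r - w ≤ ½ ^ m
  close m {T} {w} {r} T-δ≤w r<T+δ = ≤-by (gap≥0 T-δ≤w ⊕ gap≥0 (ℚ.<⇒≤ r<T+δ))
    (trans (½^-halves m) (solve 4 (λ e t w r → e :+ e := (r :- w) :+ ((w :- (t :- e)) :+ ((t :+ e) :- r))) refl (½ ^ suc m) T w r))

lemma10 : (q α₁ α₂ α₃ : ℚ) →
    + 5 / 1 < q →
    ¬ (- (+ 2 / 1) ≤ α₁ × α₁ ≤ 0ℚ) →
    - (+ 2 / 1) < α₂ × α₂ < 0ℚ →
    α₃ < - 1ℚ →
    (T⁻ T⁺ : ℝ) →
    fromℚ 0ℚ <ᴿ T⁻ →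
    T⁻ ≤ᴿ T⁺ →
    Σ (List ℕ) λ p →
    Σ ℝ λ π₀ →
    fromℚ 0ℚ <ᴿ π₀ ×
    ((T* : ℝ) → T⁻ ≤ᴿ T* → T* ≤ᴿ T⁺ →
    (π : ℝ) → fromℚ 0ℚ <ᴿ π → π ≤ᴿ π₀ →
    Σ TwoTerminalPlanarGraph λ Υ →
    let open TwoTerminalPlanarGraph Υ in
    Σ (E → ℚ) λ ŵ →
    (∀ e → ŵ e ≡ α₁ ⊎ ŵ e ≡ α₂ ⊎ ŵ e ≡ α₃) ×
    (∃ λ w* → Implements q Υ ŵ w* × T* ≤ᴿ w* ⊹ π × fromℚ w* ≤ᴿ T*) ×
    size ≤poly p [log π ⁻¹])
lemma10 q α₁ _ _ 5<q α₁∉ _ _ T⁻ T⁺ (a , a>0 , La) _ =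
  let b , Ub              = ℝ.U-inhabited T⁺
      -- `b + 1ℚ` leaves the room that `≤ᴿ⇒U` needs to pass from the upper cut of `T⁺` to that of
      -- `T*`.
      C , h , k , approx = approximate {b = b + 1ℚ} (ℚ.<-trans (ℚ.positive⁻¹ (+ 5 / 1)) 5<q) (square-expanding α₁∉) a>0
  in sizePoly C h k , fromℚ 1ℚ , (½ , 0<½ , ½^-suc 0) , λ T* T⁻≤T* T*≤T⁺ π π>0 _ →
     let (_ , _ , c) , implemented , small = realise {C = C} {h} {k} approx T*
           (T⁻≤T* a La) (≤ᴿ⇒U T* T⁺ T*≤T⁺ (<-by (ℚ.positive⁻¹ 1ℚ) refl) Ub) π π>0
     in gadget c , (λ _ → α₁) , (λ _ → inj₁ refl) , implemented , small
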